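{- Let $p>3$ be a prime, let $a\in\mathbb{Z}_p$ with $a\not\equiv0\pmod p$, let $\langle a\rangle_p$ be the least nonnegative residue of $a$ modulo $p$, and let $t=(a-\langle a\rangle_p)/p$. Then $$\sum_{k=0}^{(p-1)/2}k\binom ak\binom{ -1-a}k\equiv\begin{cases}(-1)^{\langle a\rangle_p}a(a+1)-\frac12pt\big(2a(a+1)E_{p-2}(-a)+2a+1\big)\pmod{p^2}&\text{if }\langle a\rangle_p\le\frac{p-1}2,\\ (-1)^{\langle a\rangle_p}a(a+1)-\frac12p(t+1)\big(2a(a+1)E_{p-2}(-a)+2a+1\big)\pmod{p^2}&\text{if }\langle a\rangle_p>\frac{p-1}2.\end{cases}$$
   Context: $\mathbb{Z}_p$ denotes the set of rational numbers whose denominator is not divisible by $p$; congruences modulo $p^m$ are taken in $\mathbb{Z}_p$. For $a\in\mathbb{Z}_p$, $\langle a\rangle_p\in\{0,1,\dots,p-1\}$ satisfies $\langle a\rangle_p\equiv a\pmod p$. $\binom xk=x(x-1)\cdots(x-k+1)/k!$. The Euler numbers are defined by $E_0=1$, $E_n=-\sum_{k=1}^{[n/2]}\binom n{2k}E_{n-2k}$ ($n\ge1$), and the Euler polynomials by $E_n(x)=2^{ -n}\sum_{r=0}^n\binom nr(2x-1)^{n-r}E_r$. -}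

module Defs where

open import Data.Nat as ℕ using (ℕ; zero; suc; _∸_; _!)
open import Data.Nat.Combinatorics using (_C_)
open import Data.Nat.Divisibility using (_∣_)
open import Data.Integer as ℤ using (ℤ; +_)
open import Data.Rational using (ℚ; _/_; _+_; _*_; _-_; -_; 0ℚ; 1ℚ; ↧ₙ_)
open import Data.Product using (Σ; _×_)
open import Relation.Binary.PropositionalEquality using (_≡_)
open import Relation.Nullary using (¬_)

fromℕ : ℕ → ℚ
fromℕ n = + n / 1

-- 1/n for n ≥ 1 (junk value 0 for n = 0, never used)
invℕ : ℕ → ℚ
invℕ zero = 0ℚ
invℕ (suc n) = + 1 / suc n

_^ℚ_ : ℚ → ℕ → ℚ
x ^ℚ zero = 1ℚ
x ^ℚ suc n = x * (x ^ℚ n)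

sumQ : (ℕ → ℚ) → ℕ → ℚ
sumQ f zero = 0ℚ
sumQ f (suc n) = sumQ f n + f n

prodQ : (ℕ → ℚ) → ℕ → ℚ
prodQ f zero = 1ℚ
prodQ f (suc n) = prodQ f n * f n

binom : ℚ → ℕ → ℚ
binom x k = prodQ (λ i → x - fromℕ i) k * invℕ (k !)

InZp : ℕ → ℚ → Set
InZp p x = ¬ (p ∣ ↧ₙ x)

Cong : ℕ → ℕ → ℚ → ℚ → Set
Cong p m x y = Σ ℚ (λ z → InZp p z × (x - y ≡ fromℕ (p ℕ.^ m) * z))

-- Euler numbers: E_0 = 1, E_n = - Σ_{k=1}^{[n/2]} C(n,2k) E_{n-2k}.
-- Defined with a fuel argument; eulerAux f n is correct whenever f > n.
eulerAux : ℕ → ℕ → ℚ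
eulerAux zero n = 1ℚ
eulerAux (suc f) zero = 1ℚ
eulerAux (suc f) (suc n) =
  - sumQ (λ j → fromℕ (suc n C (2 ℕ.* suc j)) * eulerAux f (suc n ∸ 2 ℕ.* suc j))
         (suc n ℕ./ 2)

euler : ℕ → ℚ
euler n = eulerAux (suc n) n

eulerPoly : ℕ → ℚ → ℚ
eulerPoly n x =
  invℕ (2 ℕ.^ n) *
  sumQ (λ r → fromℕ (n C r) * (((fromℕ 2 * x) - 1ℚ) ^ℚ (n ∸ r)) * euler r) (suc n)

{-# OPTIONS --safe #-}
module Submission where

-- Put n = (p-1)/2 and u_k = C(a,k) C(-1-a,k). The sum telescopes to
--   Σ k u_k = a(a+1) S₀(a) - (n+1+a) G(a),   S₀ = Σ u_k,   G(a) = a C(a-1,n) C(-1-a,n).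
-- From (a-n) G(a+1) = (a+n+1) G(a) and 2n+1 = p one gets G(a) ≡ a - r (mod p²) for a ≡ r, 0 ≤ r ≤ n.
-- Both S₀ and the Euler polynomial satisfy a first-order recurrence in a,
--   S₀(a) + S₀(a-1) = 2 G(a)/a   and   E_{p-2}(-a) + E_{p-2}(1-a) = 2 (-a)^{p-2},
-- which match by Fermat's theorem and give S₀(a) ≡ (-1)^r - (a-r) E_{p-2}(-a) (mod p²) by descent
-- from r = n. There S₀ depends only on a(a+1) ≡ n(n+1) (mod p²), and E_{p-2}(-a) ≡ 0 (mod p)
-- because -2a-1 ≡ 0 (mod p) and the Euler number E_{p-2} vanishes.
-- The case r > n follows from the symmetry a ↦ -1-a.

open import Defs
open import Data.Nat as ℕ using (ℕ; zero; suc; _<_; _≤_; _>_; _∸_; _!; s≤s; z≤n)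
import Data.Nat.Properties as ℕ
import Data.Nat.DivMod as ℕ
open import Data.Nat.Combinatorics using (_C_; nCn≡1; nCk≡nC[n∸k]; nCk+nC[k+1]≡[n+1]C[k+1]; k![n∸k]!∣n!)
open import Data.Nat.Combinatorics.Specification using (k>n⇒nCk≡0; nCk≡n!/k![n-k]!)
open import Data.Nat.Coprimality using (coprime?)
open import Data.Nat.Divisibility using (_∣_; divides; ∣1⇒≡1; ∣⇒≤; n∣m*n; m∣m*n; ∣-trans)
open import Data.Nat.Primality using (Prime; euclidsLemma; prime⇒nonZero; ¬prime[1]; prime⇒irreducible)
open import Data.Integer as ℤ using (ℤ; ∣_∣)
import Data.Integer.Properties as ℤ
import Data.Integer.Divisibility.Signed as ℤ
open import Data.Rational using (ℚ; mkℚ; _/_; _+_; _*_; _-_; -_; 1ℚ; 0ℚ; ½; ↧ₙ_; ↥_; ↧_; toℚᵘ)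
open import Data.Rational.Properties
open import Data.Rational.Solver using (module +-*-Solver)
open +-*-Solver using (solve; _:+_; _:*_; _:-_; :-_; con; _:=_)
import Data.Rational.Unnormalised as ℚᵘ
import Data.Rational.Unnormalised.Properties as ℚᵘ
open import Data.Product using (_×_; _,_; ∃)
open import Data.Sum using (_⊎_; inj₁; inj₂)
open import Relation.Nullary using (¬_; contradiction; recompute)
open import Relation.Binary.PropositionalEquality
open ≡-Reasoning

-- The descent starts at r = n because n ≡ -1/2 (mod p) is the fixed point of a ↦ -1-a modulo p.
-- Since a(a+1) - n(n+1) = (a-n)(a-n+p), the linear term in a - n disappears modulo p² and the exact
-- value S₀(n) = (-1)^n is enough; at another class a derivative would be required. Going down, the
-- recurrences are divided by a + 1 ≡ r + 1 with 1 ≤ r + 1 ≤ n, which is a unit. Fermat's theorem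
-- modulo p suffices for a result modulo p²: E_{p-2}(-a) only enters multiplied by a - r, which
-- supplies the second factor p. The bracket on the right-hand side has two sources. The correction
-- of S₀ gives a(a+1)E_{p-2}(-a). The boundary term gives (2a+1)/2, because n + 1 + a = ((2n+1) +
-- (2a+1))/2 and the half of 2n + 1 = p is absorbed by G(a) ≡ 0 (mod p). If r > n, then -1-a has
-- residue p-1-r, and its distance from that residue is -p(t+1); hence t + 1 in the second case.

-- Integers and natural numbers inside the rationals

ι : ℤ → ℚ
ι i = i / 1

toℚᵘ-ι : ∀ i → toℚᵘ (ι i) ℚᵘ.≃ ℚᵘ.mkℚᵘ i 0
toℚᵘ-ι i = toℚᵘ-fromℚᵘ (ℚᵘ.mkℚᵘ i 0)

ι-+ : ∀ i j → ι (i ℤ.+ j) ≡ ι i + ι j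
ι-+ i j = toℚᵘ-injective (ℚᵘ.≃-trans (toℚᵘ-ι (i ℤ.+ j))
  (ℚᵘ.≃-trans (ℚᵘ.*≡* (cong (ℤ._* ℤ.1ℤ) (sym (cong₂ ℤ._+_ (ℤ.*-identityʳ i) (ℤ.*-identityʳ j)))))
  (ℚᵘ.≃-sym (ℚᵘ.≃-trans (toℚᵘ-homo-+ (ι i) (ι j)) (ℚᵘ.+-cong (toℚᵘ-ι i) (toℚᵘ-ι j))))))

ι-* : ∀ i j → ι (i ℤ.* j) ≡ ι i * ι j
ι-* i j = toℚᵘ-injective (ℚᵘ.≃-trans (toℚᵘ-ι (i ℤ.* j))
  (ℚᵘ.≃-sym (ℚᵘ.≃-trans (toℚᵘ-homo-* (ι i) (ι j)) (ℚᵘ.*-cong (toℚᵘ-ι i) (toℚᵘ-ι j)))))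

*-clear-denominator : ∀ x → x * ι (↧ x) ≡ ι (↥ x)
*-clear-denominator x = toℚᵘ-injective (ℚᵘ.≃-trans (toℚᵘ-homo-* x (ι (↧ x)))
  (ℚᵘ.≃-trans (ℚᵘ.*-congˡ {toℚᵘ x} (toℚᵘ-ι (↧ x)))
  (ℚᵘ.≃-trans (lem x) (ℚᵘ.≃-sym (toℚᵘ-ι (↥ x))))))
  where
  lem : ∀ x → toℚᵘ x ℚᵘ.* ℚᵘ.mkℚᵘ (↧ x) 0 ℚᵘ.≃ ℚᵘ.mkℚᵘ (↥ x) 0
  lem (mkℚ n d _) = ℚᵘ.*≡* (trans (ℤ.*-identityʳ _)
    (cong (λ k → n ℤ.* ℤ.+ k) (sym (ℕ.*-identityʳ (suc d)))))

cross-multiply : ∀ x i j → x * ι i ≡ ι j → ↥ x ℤ.* i ≡ j ℤ.* ↧ x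
cross-multiply x i j eq with lem x
  (ℚᵘ.≃-trans (ℚᵘ.≃-sym (ℚᵘ.≃-trans (toℚᵘ-homo-* x (ι i)) (ℚᵘ.*-congˡ {toℚᵘ x} (toℚᵘ-ι i))))
  (ℚᵘ.≃-trans (ℚᵘ.≃-reflexive (cong toℚᵘ eq)) (toℚᵘ-ι j)))
  where
  lem : ∀ x → toℚᵘ x ℚᵘ.* ℚᵘ.mkℚᵘ i 0 ℚᵘ.≃ ℚᵘ.mkℚᵘ j 0 → ↥ x ℤ.* i ≡ j ℤ.* ↧ x
  lem (mkℚ n d _) (ℚᵘ.*≡* e) = trans (sym (ℤ.*-identityʳ _))
    (trans e (cong (λ k → j ℤ.* ℤ.+ k) (ℕ.*-identityʳ (suc d))))
... | e = e

ι-injective : ∀ i j → ι i ≡ ι j → i ≡ j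
ι-injective i j eq with ℚᵘ.≃-trans (ℚᵘ.≃-sym (toℚᵘ-ι i)) (ℚᵘ.≃-trans (ℚᵘ.≃-reflexive (cong toℚᵘ eq)) (toℚᵘ-ι j))
... | ℚᵘ.*≡* e = trans (sym (ℤ.*-identityʳ i)) (trans e (ℤ.*-identityʳ j))

fromℕ-+ : ∀ m n → fromℕ (m ℕ.+ n) ≡ fromℕ m + fromℕ n
fromℕ-+ m n = ι-+ (ℤ.+ m) (ℤ.+ n)

fromℕ-* : ∀ m n → fromℕ (m ℕ.* n) ≡ fromℕ m * fromℕ n
fromℕ-* m n = trans (cong ι (ℤ.pos-* m n)) (ι-* (ℤ.+ m) (ℤ.+ n))

fromℕ-suc : ∀ n → fromℕ (suc n) ≡ fromℕ n + 1ℚ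
fromℕ-suc n = trans (fromℕ-+ 1 n) (+-comm 1ℚ (fromℕ n))

invℕ-inverse : ∀ n .{{_ : ℕ.NonZero n}} → invℕ n * fromℕ n ≡ 1ℚ
invℕ-inverse (suc n) = toℚᵘ-injective
  (ℚᵘ.≃-trans (toℚᵘ-homo-* (ℤ.+ 1 / suc n) (fromℕ (suc n)))
  (ℚᵘ.≃-trans (ℚᵘ.*-cong (toℚᵘ-fromℚᵘ (ℚᵘ.mkℚᵘ (ℤ.+ 1) n)) (toℚᵘ-ι (ℤ.+ suc n)))
  (ℚᵘ.*≡* (cong ℤ.+_ (lem (suc n))))))
  where
  lem : ∀ k → (1 ℕ.* k) ℕ.* 1 ≡ 1 ℕ.* (k ℕ.* 1)
  lem k = ℕ.*-assoc 1 k 1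

*-cancelˡ-fromℕ : ∀ n .{{_ : ℕ.NonZero n}} {x y} → fromℕ n * x ≡ fromℕ n * y → x ≡ y
*-cancelˡ-fromℕ n {x} {y} eq = trans (sym (lem x)) (trans (cong (invℕ n *_) eq) (lem y))
  where
  lem : ∀ z → invℕ n * (fromℕ n * z) ≡ z
  lem z = trans (sym (*-assoc (invℕ n) (fromℕ n) z)) (trans (cong (_* z) (invℕ-inverse n)) (*-identityˡ z))

-- Lets the ring solver use a hypothesis `u ≡ v`: the caller supplies a cofactor `c`, and what
-- remains is a polynomial identity in which `u` and `v` are unrelated.
linear-combination : ∀ {x y u v} c → u ≡ v → x ≡ y + c * (u - v) → x ≡ y
linear-combination {y = y} {u} c refl eq = trans eq
  (solve 3 (λ y c u → y :+ c :* (u :- u) := y) refl y c u)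

-- Finite sums and parity

sumQ-cong : ∀ {f g} n → (∀ i → i < n → f i ≡ g i) → sumQ f n ≡ sumQ g n
sumQ-cong zero f≡g = refl
sumQ-cong (suc n) f≡g = cong₂ _+_ (sumQ-cong n (λ i i<n → f≡g i (ℕ.m<n⇒m<1+n i<n))) (f≡g n (ℕ.n<1+n n))

sumQ-+ : ∀ f g n → sumQ (λ i → f i + g i) n ≡ sumQ f n + sumQ g n
sumQ-+ f g zero = refl
sumQ-+ f g (suc n) = trans (cong (_+ (f n + g n)) (sumQ-+ f g n))
  (solve 4 (λ a b c d → a :+ b :+ (c :+ d) := a :+ c :+ (b :+ d)) refl (sumQ f n) (sumQ g n) (f n) (g n))

sumQ-head : ∀ f n → sumQ f (suc n) ≡ f 0 + sumQ (λ i → f (suc i)) n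
sumQ-head f zero = +-comm 0ℚ (f 0)
sumQ-head f (suc n) = trans (cong (_+ f (suc n)) (sumQ-head f n)) (+-assoc (f 0) _ _)

sumQ-reverse : ∀ f n → sumQ f (suc n) ≡ sumQ (λ i → f (n ∸ i)) (suc n)
sumQ-reverse f zero = refl
sumQ-reverse f (suc n) = trans (+-comm _ (f (suc n))) (trans (cong (f (suc n) +_) (sumQ-reverse f n))
  (sym (sumQ-head (λ i → f (suc n ∸ i)) (suc n))))

sumQ-zero : ∀ {f} n → (∀ i → i < n → f i ≡ 0ℚ) → sumQ f n ≡ 0ℚ
sumQ-zero zero f≡0 = refl
sumQ-zero (suc n) f≡0 = trans (cong₂ _+_ (sumQ-zero n (λ i i<n → f≡0 i (ℕ.m<n⇒m<1+n i<n))) (f≡0 n (ℕ.n<1+n n))) refl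

even⊎odd : ∀ n → (n ≡ n ℕ./ 2 ℕ.* 2) ⊎ (n ≡ suc (n ℕ./ 2 ℕ.* 2))
even⊎odd n with n ℕ.% 2 | ℕ.m%n<n n 2 | ℕ.m≡m%n+[m/n]*n n 2
... | 0 | _ | eq = inj₁ eq
... | 1 | _ | eq = inj₂ eq
... | suc (suc _) | s≤s (s≤s ()) | _

[1+k*2]/2 : ∀ k → suc (k ℕ.* 2) ℕ./ 2 ≡ k
[1+k*2]/2 k with even⊎odd (suc (k ℕ.* 2))
... | inj₂ eq = sym (ℕ.*-cancelʳ-≡ k _ 2 (ℕ.suc-injective eq))
... | inj₁ eq = contradiction eq (λ e → ℕ.even≢odd (suc (k ℕ.* 2) ℕ./ 2) k (trans (ℕ.*-comm 2 (suc (k ℕ.* 2) ℕ./ 2)) (trans (sym e) (cong suc (ℕ.*-comm k 2)))))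

-1^even : ∀ k → (- 1ℚ) ^ℚ (k ℕ.* 2) ≡ 1ℚ
-1^even zero = refl
-1^even (suc k) = cong (λ s → - 1ℚ * (- 1ℚ * s)) (-1^even k)

-- The factor 1 + (-1)^i is 2 at even i and 0 at odd i. It arises in `Ψ±1-euler`, where the
-- expansions at 1 and -1 are added.
sumQ-even : ∀ (h : ℕ → ℚ) n → sumQ (λ i → (1ℚ + (- 1ℚ) ^ℚ i) * h i) (suc n) ≡ fromℕ 2 * sumQ (λ j → h (2 ℕ.* j)) (suc (n ℕ./ 2))
sumQ-even h n = by-parity (even⊎odd n)
  where
  F : ℕ → ℚ
  F i = (1ℚ + (- 1ℚ) ^ℚ i) * h i
  F-even : ∀ q → F (q ℕ.* 2) ≡ fromℕ 2 * h (2 ℕ.* q)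
  F-even q = cong₂ (λ s t → (1ℚ + s) * h t) (-1^even q) (ℕ.*-comm q 2)
  F-odd : ∀ q → F (suc (q ℕ.* 2)) ≡ 0ℚ
  F-odd q = trans (cong (λ s → (1ℚ + - 1ℚ * s) * h (suc (q ℕ.* 2))) (-1^even q)) (*-zeroˡ (h (suc (q ℕ.* 2))))
  even : ∀ q → sumQ F (suc (q ℕ.* 2)) ≡ fromℕ 2 * sumQ (λ j → h (2 ℕ.* j)) (suc q)
  even zero = solve 1 (λ x → con 0ℚ :+ con (fromℕ 2) :* x := con (fromℕ 2) :* (con 0ℚ :+ x)) refl (h 0)
  even (suc q) = trans (cong₂ _+_ (cong₂ _+_ (even q) (F-odd q)) (F-even (suc q)))
    (solve 2 (λ x y → con (fromℕ 2) :* x :+ con 0ℚ :+ con (fromℕ 2) :* y := con (fromℕ 2) :* (x :+ y)) refl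
      (sumQ (λ j → h (2 ℕ.* j)) (suc q)) (h (2 ℕ.* suc q)))
  by-parity : (n ≡ n ℕ./ 2 ℕ.* 2) ⊎ (n ≡ suc (n ℕ./ 2 ℕ.* 2)) →
    sumQ F (suc n) ≡ fromℕ 2 * sumQ (λ j → h (2 ℕ.* j)) (suc (n ℕ./ 2))
  by-parity (inj₁ eq) = trans (cong (λ s → sumQ F (suc s)) eq) (even (n ℕ./ 2))
  by-parity (inj₂ eq) = trans (cong (λ s → sumQ F (suc s)) eq)
    (trans (cong₂ _+_ (even (n ℕ./ 2)) (F-odd (n ℕ./ 2))) (+-identityʳ (fromℕ 2 * sumQ (λ j → h (2 ℕ.* j)) (suc (n ℕ./ 2)))))

nC0≡1 : ∀ n → n C 0 ≡ 1
nC0≡1 n = trans (nCk≡nC[n∸k] {0} {n} z≤n) (nCn≡1 n)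

-- Umbral calculus and Euler polynomials

-- Ψ m z E = (z + E)^m in umbral notation: each step applies the operator z + shift to E.
Ψ : ℕ → ℚ → (ℕ → ℚ) → ℚ
Ψ zero z E = E 0
Ψ (suc m) z E = Ψ m z (λ i → z * E i + E (suc i))

Ψ-cong : ∀ m z {E F} → (∀ i → E i ≡ F i) → Ψ m z E ≡ Ψ m z F
Ψ-cong zero z E≡F = E≡F 0
Ψ-cong (suc m) z E≡F = Ψ-cong m z (λ i → cong₂ (λ s t → z * s + t) (E≡F i) (E≡F (suc i)))

Ψ-linear : ∀ m z b c E F → Ψ m z (λ i → b * E i + c * F i) ≡ b * Ψ m z E + c * Ψ m z F
Ψ-linear zero z b c E F = refl
Ψ-linear (suc m) z b c E F = trans
  (Ψ-cong m z (λ i → solve 7 (λ z b c e f e′ f′ → z :* (b :* e :+ c :* f) :+ (b :* e′ :+ c :* f′)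
      := b :* (z :* e :+ e′) :+ c :* (z :* f :+ f′)) refl z b c (E i) (F i) (E (suc i)) (F (suc i))))
  (Ψ-linear m z b c (λ i → z * E i + E (suc i)) (λ i → z * F i + F (suc i)))

-- Umbrally, (w + (z + E))^m = ((w + z) + E)^m: on the sequence of powers of z + E the shift acts as
-- z + shift on E.
Ψ-shift : ∀ m w z E → Ψ m w (λ i → Ψ i z E) ≡ Ψ m (w + z) E
Ψ-shift zero w z E = refl
Ψ-shift (suc m) w z E = begin
  Ψ m w (λ i → w * Ψ i z E + Ψ i z (λ j → z * E j + E (suc j)))
    ≡⟨ Ψ-cong m w (λ i → trans (cong (w * Ψ i z E +_) (sym (*-identityˡ _)))
        (trans (sym (Ψ-linear i z w 1ℚ E (λ j → z * E j + E (suc j))))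
        (Ψ-cong i z (λ j → solve 4 (λ w z e e′ → w :* e :+ con 1ℚ :* (z :* e :+ e′) := (w :+ z) :* e :+ e′) refl w z (E j) (E (suc j)))))) ⟩
  Ψ m w (λ i → Ψ i z (λ j → (w + z) * E j + E (suc j)))
    ≡⟨ Ψ-shift m w z (λ j → (w + z) * E j + E (suc j)) ⟩
  Ψ m (w + z) (λ j → (w + z) * E j + E (suc j)) ∎

-- The sequence c * 0^i, that is, the umbra 0 scaled by c.
δ : ℚ → ℕ → ℚ
δ c zero = c
δ c (suc _) = 0ℚ

Ψ-δ : ∀ m z c → Ψ m z (δ c) ≡ c * z ^ℚ m
Ψ-δ zero z c = sym (*-identityʳ c)
Ψ-δ (suc m) z c = trans (Ψ-cong m z lem) (trans (Ψ-δ m z (c * z)) (*-assoc c z (z ^ℚ m)))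
  where
  lem : ∀ i → z * δ c i + δ c (suc i) ≡ δ (c * z) i
  lem zero = solve 2 (λ z c → z :* c :+ con 0ℚ := c :* z) refl z c
  lem (suc i) = solve 1 (λ z → z :* con 0ℚ :+ con 0ℚ := con 0ℚ) refl z

-- Umbrally, (-z + E)^m = (-1)^m (z - E)^m, where -E stands for the sequence (-1)^i E_i.
Ψ-neg : ∀ m z E → Ψ m (- z) E ≡ (- 1ℚ) ^ℚ m * Ψ m z (λ i → (- 1ℚ) ^ℚ i * E i)
Ψ-neg zero z E = solve 1 (λ e → e := con 1ℚ :* (con 1ℚ :* e)) refl (E 0)
Ψ-neg (suc m) z E = begin
  Ψ m (- z) (λ i → - z * E i + E (suc i))
    ≡⟨ Ψ-neg m z _ ⟩
  s * Ψ m z (λ i → (- 1ℚ) ^ℚ i * (- z * E i + E (suc i)))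
    ≡⟨ cong (s *_) (Ψ-cong m z (λ i → solve 4 (λ z e e′ t → t :* (:- z :* e :+ e′)
         := (:- con 1ℚ) :* (z :* (t :* e) :+ (:- con 1ℚ) :* t :* e′) :+ con 0ℚ :* con 0ℚ) refl z (E i) (E (suc i)) ((- 1ℚ) ^ℚ i))) ⟩
  s * Ψ m z (λ i → - 1ℚ * F i + 0ℚ * 0ℚ)
    ≡⟨ cong (s *_) (Ψ-linear m z (- 1ℚ) 0ℚ F (λ _ → 0ℚ)) ⟩
  s * (- 1ℚ * Ψ m z F + 0ℚ * Ψ m z (λ _ → 0ℚ))
    ≡⟨ solve 3 (λ s x y → s :* ((:- con 1ℚ) :* x :+ con 0ℚ :* y) := (:- con 1ℚ) :* s :* x) refl s (Ψ m z F) (Ψ m z (λ _ → 0ℚ)) ⟩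
  - 1ℚ * s * Ψ m z F ∎
  where
  s = (- 1ℚ) ^ℚ m
  F : ℕ → ℚ
  F i = z * ((- 1ℚ) ^ℚ i * E i) + - 1ℚ * (- 1ℚ) ^ℚ i * E (suc i)

Ψ-binomial : ∀ m z E → Ψ m z E ≡ sumQ (λ r → fromℕ (m C r) * z ^ℚ (m ∸ r) * E r) (suc m)
Ψ-binomial zero z E = solve 1 (λ e → e := con 0ℚ :+ con 1ℚ :* con 1ℚ :* e) refl (E 0)
Ψ-binomial (suc m) z E = begin
  Ψ m z (λ i → z * E i + E (suc i))
    ≡⟨ Ψ-binomial m z _ ⟩
  sumQ (λ r → fromℕ (m C r) * z ^ℚ (m ∸ r) * (z * E r + E (suc r))) (suc m)
    ≡⟨ sumQ-cong (suc m) split ⟩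
  sumQ (λ r → A r + B r) (suc m)
    ≡⟨ sumQ-+ A B (suc m) ⟩
  sumQ A (suc m) + sumQ B (suc m)
    -- The sum of `A` is padded with its zero term at index m + 1, so that its tail lines up with
    -- `B` for Pascal's rule.
    ≡⟨ cong (_+ sumQ B (suc m)) (trans (sym (+-identityʳ (sumQ A (suc m)))) (cong (sumQ A (suc m) +_) (sym A-last))) ⟩
  sumQ A (suc (suc m)) + sumQ B (suc m)
    ≡⟨ cong (_+ sumQ B (suc m)) (sumQ-head A (suc m)) ⟩
  A 0 + sumQ (λ r → A (suc r)) (suc m) + sumQ B (suc m)
    ≡⟨ +-assoc (A 0) _ _ ⟩
  A 0 + (sumQ (λ r → A (suc r)) (suc m) + sumQ B (suc m))
    ≡⟨ cong (A 0 +_) (sym (sumQ-+ (λ r → A (suc r)) B (suc m))) ⟩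
  A 0 + sumQ (λ r → A (suc r) + B r) (suc m)
    ≡⟨ cong₂ _+_ (cong (λ c → fromℕ c * z ^ℚ (suc m) * E 0) (trans (nC0≡1 m) (sym (nC0≡1 (suc m)))))
         (sumQ-cong (suc m) (λ r _ → pascal r)) ⟩
  T 0 + sumQ (λ r → T (suc r)) (suc m)
    ≡⟨ sumQ-head T (suc m) ⟨
  sumQ T (suc (suc m)) ∎
  where
  A B T : ℕ → ℚ
  A r = fromℕ (m C r) * z ^ℚ (suc m ∸ r) * E r
  B r = fromℕ (m C r) * z ^ℚ (m ∸ r) * E (suc r)
  T r = fromℕ (suc m C r) * z ^ℚ (suc m ∸ r) * E r
  A-last : A (suc m) ≡ 0ℚ
  A-last = trans (cong (λ c → fromℕ c * z ^ℚ (m ∸ m) * E (suc m)) (k>n⇒nCk≡0 (ℕ.n<1+n m)))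
    (solve 2 (λ x y → con 0ℚ :* x :* y := con 0ℚ) refl (z ^ℚ (m ∸ m)) (E (suc m)))
  split : ∀ r → r < suc m → fromℕ (m C r) * z ^ℚ (m ∸ r) * (z * E r + E (suc r)) ≡ A r + B r
  split r (s≤s r≤m) = trans
    (solve 5 (λ c w z e e′ → c :* w :* (z :* e :+ e′) := c :* (z :* w) :* e :+ c :* w :* e′) refl
      (fromℕ (m C r)) (z ^ℚ (m ∸ r)) z (E r) (E (suc r)))
    (cong (λ k → fromℕ (m C r) * z ^ℚ k * E r + B r) (sym (ℕ.+-∸-assoc 1 r≤m)))
  pascal : ∀ r → A (suc r) + B r ≡ T (suc r)
  pascal r = trans (solve 4 (λ c c′ w e → c′ :* w :* e :+ c :* w :* e := (c :+ c′) :* w :* e) refl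
      (fromℕ (m C r)) (fromℕ (m C suc r)) (z ^ℚ (m ∸ r)) (E (suc r)))
    (cong (λ c → c * z ^ℚ (m ∸ r) * E (suc r))
      (trans (sym (fromℕ-+ (m C r) (m C suc r))) (cong fromℕ (nCk+nC[k+1]≡[n+1]C[k+1] m r))))

-- `euler` takes fresh fuel at each index, whereas the recursion hands down what is left; this
-- reconciles the two in `euler-sum`.
eulerAux-fuel : ∀ f g n → n < f → n < g → eulerAux f n ≡ eulerAux g n
eulerAux-fuel (suc f) (suc g) zero _ _ = refl
eulerAux-fuel (suc f) (suc g) (suc n) (s≤s n<f) (s≤s n<g) = cong -_ (sumQ-cong (suc n ℕ./ 2)
  (λ j _ → cong (fromℕ (suc n C (2 ℕ.* suc j)) *_)
    (eulerAux-fuel f g (suc n ∸ 2 ℕ.* suc j) (ℕ.<-≤-trans (lem j) n<f) (ℕ.<-≤-trans (lem j) n<g))))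
  where
  lem : ∀ j → suc n ∸ 2 ℕ.* suc j < suc n
  lem j = s≤s (ℕ.m∸n≤m n (j ℕ.+ suc (j ℕ.+ 0)))

-- The recurrence lowers an odd index by positive even amounts, so all its terms again have odd
-- index; at index 1 the sum is empty.
eulerAux-odd : ∀ f k → suc (k ℕ.* 2) < f → eulerAux f (suc (k ℕ.* 2)) ≡ 0ℚ
eulerAux-odd (suc f) k (s≤s k<f) = trans (cong (λ q → - sumQ term q) ([1+k*2]/2 k))
  (cong -_ (sumQ-zero k (λ j j<k → trans (cong (fromℕ (suc (k ℕ.* 2) C (2 ℕ.* suc j)) *_)
    (trans (cong (eulerAux f) (index j j<k)) (eulerAux-odd f (k ∸ suc j)
      (ℕ.≤-trans (ℕ.*-monoˡ-≤ 2 (ℕ.∸-monoʳ-< {k} {suc j} {0} (s≤s z≤n) j<k)) (ℕ.<⇒≤ k<f)))))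
    (*-zeroʳ (fromℕ (suc (k ℕ.* 2) C (2 ℕ.* suc j)))))))
  where
  term : ℕ → ℚ
  term j = fromℕ (suc (k ℕ.* 2) C (2 ℕ.* suc j)) * eulerAux f (suc (k ℕ.* 2) ∸ 2 ℕ.* suc j)
  index : ∀ j → j < k → suc (k ℕ.* 2) ∸ 2 ℕ.* suc j ≡ suc ((k ∸ suc j) ℕ.* 2)
  index j j<k = begin
    suc (k ℕ.* 2) ∸ 2 ℕ.* suc j     ≡⟨ cong (suc (k ℕ.* 2) ∸_) (ℕ.*-comm 2 (suc j)) ⟩
    suc (k ℕ.* 2) ∸ suc j ℕ.* 2     ≡⟨ ℕ.+-∸-assoc 1 (ℕ.*-monoˡ-≤ 2 j<k) ⟩
    suc (k ℕ.* 2 ∸ suc j ℕ.* 2)     ≡⟨ cong suc (ℕ.*-distribʳ-∸ 2 k (suc j)) ⟨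
    suc ((k ∸ suc j) ℕ.* 2)         ∎

euler-odd : ∀ k → euler (suc (k ℕ.* 2)) ≡ 0ℚ
euler-odd k = eulerAux-odd _ k (ℕ.n<1+n _)

euler-sum : ∀ n → sumQ (λ j → fromℕ (suc n C (2 ℕ.* j)) * euler (suc n ∸ 2 ℕ.* j)) (suc (suc n ℕ./ 2)) ≡ 0ℚ
euler-sum n = begin
  sumQ term (suc q)                            ≡⟨ sumQ-head term q ⟩
  term 0 + sumQ (λ j → term (suc j)) q         ≡⟨ cong₂ _+_ (trans (cong (λ c → fromℕ c * euler (suc n)) (nC0≡1 (suc n))) (*-identityˡ (euler (suc n))))
                                                    (sumQ-cong q (λ j _ → cong (fromℕ (suc n C (2 ℕ.* suc j)) *_)
                                                      (eulerAux-fuel _ (suc n) (suc n ∸ 2 ℕ.* suc j) (ℕ.n<1+n _) (s≤s (ℕ.m∸n≤m n (j ℕ.+ suc (j ℕ.+ 0))))))) ⟩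
  euler (suc n) + sumQ rest q                  ≡⟨ +-inverseˡ (sumQ rest q) ⟩
  0ℚ                                           ∎
  where
  q = suc n ℕ./ 2
  term rest : ℕ → ℚ
  term j = fromℕ (suc n C (2 ℕ.* j)) * euler (suc n ∸ 2 ℕ.* j)
  rest j = fromℕ (suc n C (2 ℕ.* suc j)) * eulerAux (suc n) (suc n ∸ 2 ℕ.* suc j)

1^ : ∀ n → 1ℚ ^ℚ n ≡ 1ℚ
1^ zero = refl
1^ (suc n) = trans (*-identityˡ (1ℚ ^ℚ n)) (1^ n)

-- Umbrally, (1 + E)^n + (-1 + E)^n = 2 * 0^n. For n ≥ 1 the odd powers of ±1 cancel and twice the
-- defining recurrence of the Euler numbers is left.
Ψ±1-euler : ∀ n → Ψ n 1ℚ euler + Ψ n (- 1ℚ) euler ≡ δ (fromℕ 2) n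
Ψ±1-euler zero = refl
Ψ±1-euler (suc n) = begin
  Ψ N 1ℚ euler + Ψ N (- 1ℚ) euler
    ≡⟨ cong₂ _+_ (Ψ-binomial N 1ℚ euler) (Ψ-binomial N (- 1ℚ) euler) ⟩
  sumQ (term 1ℚ) (suc N) + sumQ (term (- 1ℚ)) (suc N)
    ≡⟨ sumQ-+ (term 1ℚ) (term (- 1ℚ)) (suc N) ⟨
  sumQ (λ r → term 1ℚ r + term (- 1ℚ) r) (suc N)
    -- Reversal makes the exponent of ±1 the summation index, the form that `sumQ-even` expects.
    ≡⟨ sumQ-reverse (λ r → term 1ℚ r + term (- 1ℚ) r) N ⟩
  sumQ (λ i → term 1ℚ (N ∸ i) + term (- 1ℚ) (N ∸ i)) (suc N)
    ≡⟨ sumQ-cong (suc N) combine ⟩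
  sumQ (λ i → (1ℚ + (- 1ℚ) ^ℚ i) * h i) (suc N)
    ≡⟨ sumQ-even h N ⟩
  fromℕ 2 * sumQ (λ j → h (2 ℕ.* j)) (suc (N ℕ./ 2))
    ≡⟨ cong (fromℕ 2 *_) (euler-sum n) ⟩
  0ℚ ∎
  where
  N = suc n
  term : ℚ → ℕ → ℚ
  term z r = fromℕ (N C r) * z ^ℚ (N ∸ r) * euler r
  h : ℕ → ℚ
  h i = fromℕ (N C i) * euler (N ∸ i)
  combine : ∀ i → i < suc N → term 1ℚ (N ∸ i) + term (- 1ℚ) (N ∸ i) ≡ (1ℚ + (- 1ℚ) ^ℚ i) * h i
  combine i (s≤s i≤N) = trans
    (cong₂ (λ c k → fromℕ c * 1ℚ ^ℚ k * euler (N ∸ i) + fromℕ c * (- 1ℚ) ^ℚ k * euler (N ∸ i))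
      (sym (nCk≡nC[n∸k] i≤N)) (ℕ.m∸[m∸n]≡n i≤N))
    (trans (cong (λ s → fromℕ (N C i) * s * euler (N ∸ i) + fromℕ (N C i) * (- 1ℚ) ^ℚ i * euler (N ∸ i)) (1^ i))
    (solve 3 (λ c s e → c :* con 1ℚ :* e :+ c :* s :* e := (con 1ℚ :+ s) :* (c :* e)) refl
      (fromℕ (N C i)) ((- 1ℚ) ^ℚ i) (euler (N ∸ i))))

eulerPoly-Ψ : ∀ m x → fromℕ (2 ℕ.^ m) * eulerPoly m x ≡ Ψ m (fromℕ 2 * x - 1ℚ) euler
eulerPoly-Ψ m x = begin
  fromℕ (2 ℕ.^ m) * (invℕ (2 ℕ.^ m) * s)     ≡⟨ solve 3 (λ a b s → a :* (b :* s) := b :* a :* s) refl (fromℕ (2 ℕ.^ m)) (invℕ (2 ℕ.^ m)) s ⟩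
  invℕ (2 ℕ.^ m) * fromℕ (2 ℕ.^ m) * s       ≡⟨ cong (_* s) (invℕ-inverse (2 ℕ.^ m)) ⟩
  1ℚ * s                                     ≡⟨ *-identityˡ s ⟩
  s                                          ≡⟨ Ψ-binomial m (fromℕ 2 * x - 1ℚ) euler ⟨
  Ψ m (fromℕ 2 * x - 1ℚ) euler               ∎
  where
  instance _ = ℕ.m^n≢0 2 m
  s = sumQ (λ r → fromℕ (m C r) * (fromℕ 2 * x - 1ℚ) ^ℚ (m ∸ r) * euler r) (suc m)

fromℕ2*x^m : ∀ m x → (fromℕ 2 * x) ^ℚ m ≡ fromℕ (2 ℕ.^ m) * x ^ℚ m
fromℕ2*x^m zero x = refl
fromℕ2*x^m (suc m) x = begin
  fromℕ 2 * x * (fromℕ 2 * x) ^ℚ m            ≡⟨ cong (fromℕ 2 * x *_) (fromℕ2*x^m m x) ⟩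
  fromℕ 2 * x * (fromℕ (2 ℕ.^ m) * x ^ℚ m)    ≡⟨ solve 4 (λ a x b y → a :* x :* (b :* y) := a :* b :* (x :* y)) refl (fromℕ 2) x (fromℕ (2 ℕ.^ m)) (x ^ℚ m) ⟩
  fromℕ 2 * fromℕ (2 ℕ.^ m) * (x * x ^ℚ m)    ≡⟨ cong (_* (x * x ^ℚ m)) (fromℕ-* 2 (2 ℕ.^ m)) ⟨
  fromℕ (2 ℕ.^ suc m) * (x * x ^ℚ m)          ∎

-- With y = 2x the two umbral arguments are y - 1 and y + 1. `Ψ-shift` moves ±1 into the umbra,
-- where `Ψ±1-euler` collapses the Euler sequence to `δ (fromℕ 2)`.
eulerPoly-add : ∀ m x → eulerPoly m x + eulerPoly m (x + 1ℚ) ≡ fromℕ 2 * x ^ℚ m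
eulerPoly-add m x = *-cancelˡ-fromℕ (2 ℕ.^ m) (begin
  T * (eulerPoly m x + eulerPoly m (x + 1ℚ))
    ≡⟨ *-distribˡ-+ T (eulerPoly m x) (eulerPoly m (x + 1ℚ)) ⟩
  T * eulerPoly m x + T * eulerPoly m (x + 1ℚ)
    ≡⟨ cong₂ _+_ (eulerPoly-Ψ m x) (eulerPoly-Ψ m (x + 1ℚ)) ⟩
  Ψ m (y - 1ℚ) euler + Ψ m (fromℕ 2 * (x + 1ℚ) - 1ℚ) euler
    ≡⟨ cong (λ z → Ψ m (y - 1ℚ) euler + Ψ m z euler)
         (solve 1 (λ x → con (fromℕ 2) :* (x :+ con 1ℚ) :- con 1ℚ := con (fromℕ 2) :* x :+ con 1ℚ) refl x) ⟩
  Ψ m (y - 1ℚ) euler + Ψ m (y + 1ℚ) euler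
    ≡⟨ cong₂ _+_ (Ψ-shift m y (- 1ℚ) euler) (Ψ-shift m y 1ℚ euler) ⟨
  Ψ m y B⁻ + Ψ m y B⁺
    ≡⟨ solve 2 (λ a b → a :+ b := con 1ℚ :* b :+ con 1ℚ :* a) refl (Ψ m y B⁻) (Ψ m y B⁺) ⟩
  1ℚ * Ψ m y B⁺ + 1ℚ * Ψ m y B⁻
    ≡⟨ Ψ-linear m y 1ℚ 1ℚ B⁺ B⁻ ⟨
  Ψ m y (λ i → 1ℚ * B⁺ i + 1ℚ * B⁻ i)
    ≡⟨ Ψ-cong m y (λ i → trans (cong₂ _+_ (*-identityˡ (B⁺ i)) (*-identityˡ (B⁻ i))) (Ψ±1-euler i)) ⟩
  Ψ m y (δ (fromℕ 2))
    ≡⟨ Ψ-δ m y (fromℕ 2) ⟩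
  fromℕ 2 * y ^ℚ m
    ≡⟨ cong (fromℕ 2 *_) (fromℕ2*x^m m x) ⟩
  fromℕ 2 * (T * x ^ℚ m)
    ≡⟨ solve 3 (λ a b c → a :* (b :* c) := b :* (a :* c)) refl (fromℕ 2) T (x ^ℚ m) ⟩
  T * (fromℕ 2 * x ^ℚ m) ∎)
  where
  instance _ = ℕ.m^n≢0 2 m
  T = fromℕ (2 ℕ.^ m)
  y = fromℕ 2 * x
  B⁺ B⁻ : ℕ → ℚ
  B⁺ i = Ψ i 1ℚ euler
  B⁻ i = Ψ i (- 1ℚ) euler

-- The Euler umbra is invariant under E ↦ -E, since the odd Euler numbers vanish; this drives
-- `eulerPoly-reflect`.
-1^i*euler : ∀ i → (- 1ℚ) ^ℚ i * euler i ≡ euler i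
-1^i*euler i with even⊎odd i
... | inj₁ eq = trans (cong (_* euler i) (trans (cong ((- 1ℚ) ^ℚ_) eq) (-1^even (i ℕ./ 2)))) (*-identityˡ (euler i))
... | inj₂ eq = trans (cong ((- 1ℚ) ^ℚ i *_) vanish) (trans (*-zeroʳ ((- 1ℚ) ^ℚ i)) (sym vanish))
  where
  vanish : euler i ≡ 0ℚ
  vanish = trans (cong euler eq) (euler-odd (i ℕ./ 2))

eulerPoly-reflect : ∀ k x → eulerPoly (suc (k ℕ.* 2)) (1ℚ - x) ≡ - eulerPoly (suc (k ℕ.* 2)) x
eulerPoly-reflect k x = *-cancelˡ-fromℕ (2 ℕ.^ m) (begin
  T * eulerPoly m (1ℚ - x)
    ≡⟨ eulerPoly-Ψ m (1ℚ - x) ⟩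
  Ψ m (fromℕ 2 * (1ℚ - x) - 1ℚ) euler
    ≡⟨ cong (λ z → Ψ m z euler) (solve 1 (λ x → con (fromℕ 2) :* (con 1ℚ :- x) :- con 1ℚ := :- (con (fromℕ 2) :* x :- con 1ℚ)) refl x) ⟩
  Ψ m (- z) euler
    ≡⟨ Ψ-neg m z euler ⟩
  (- 1ℚ) ^ℚ m * Ψ m z (λ i → (- 1ℚ) ^ℚ i * euler i)
    ≡⟨ cong₂ _*_ (cong (- 1ℚ *_) (-1^even k)) (Ψ-cong m z -1^i*euler) ⟩
  - 1ℚ * Ψ m z euler
    ≡⟨ cong (- 1ℚ *_) (eulerPoly-Ψ m x) ⟨
  - 1ℚ * (T * eulerPoly m x)
    ≡⟨ solve 2 (λ t e → (:- con 1ℚ) :* (t :* e) := t :* (:- e)) refl T (eulerPoly m x) ⟩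
  T * (- eulerPoly m x) ∎)
  where
  m = suc (k ℕ.* 2)
  instance _ = ℕ.m^n≢0 2 m
  T = fromℕ (2 ℕ.^ m)
  z = fromℕ 2 * x - 1ℚ

linear-combination₂ : ∀ {x y u v u′ v′} c c′ → u ≡ v → u′ ≡ v′ → x ≡ y + c * (u - v) + c′ * (u′ - v′) → x ≡ y
linear-combination₂ {y = y} {u} {u′ = u′} c c′ refl refl eq = trans eq
  (solve 5 (λ y c u c′ u′ → y :+ c :* (u :- u) :+ c′ :* (u′ :- u′) := y) refl y c u c′ u′)

-- Binomial sums

binom-suc : ∀ x k → fromℕ (suc k) * binom x (suc k) ≡ (x - fromℕ k) * binom x k
binom-suc x k = begin
  s * (prodQ f k * (x - fromℕ k) * I′)     ≡⟨ solve 4 (λ s q y i → s :* (q :* y :* i) := y :* (q :* (i :* s))) refl s (prodQ f k) (x - fromℕ k) I′ ⟩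
  (x - fromℕ k) * (prodQ f k * (I′ * s))   ≡⟨ cong (λ t → (x - fromℕ k) * (prodQ f k * t)) I′*s≡I ⟩
  (x - fromℕ k) * (prodQ f k * I)          ∎
  where
  instance
    _ = ℕ._!≢0 k
    _ = ℕ._!≢0 (suc k)
  f : ℕ → ℚ
  f i = x - fromℕ i
  s = fromℕ (suc k)
  I = invℕ (k !)
  I′ = invℕ (suc k !)
  I′*s≡I : I′ * s ≡ I
  I′*s≡I = *-cancelˡ-fromℕ (k !) (begin
    fromℕ (k !) * (I′ * s)       ≡⟨ solve 3 (λ a i s → a :* (i :* s) := i :* (s :* a)) refl (fromℕ (k !)) I′ s ⟩
    I′ * (s * fromℕ (k !))       ≡⟨ cong (I′ *_) (fromℕ-* (suc k) (k !)) ⟨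
    I′ * fromℕ (suc k !)         ≡⟨ invℕ-inverse (suc k !) ⟩
    1ℚ                           ≡⟨ invℕ-inverse (k !) ⟨
    I * fromℕ (k !)              ≡⟨ *-comm I (fromℕ (k !)) ⟩
    fromℕ (k !) * I              ∎)

binom-absorb : ∀ a k → (a - fromℕ k) * binom a k ≡ a * binom (a - 1ℚ) k
binom-absorb a zero = solve 1 (λ a → (a :- con 0ℚ) :* con 1ℚ := a :* con 1ℚ) refl a
binom-absorb a (suc k) = *-cancelˡ-fromℕ (suc k) (begin
  s * ((a - s) * binom a (suc k))                    ≡⟨ swap s (a - s) (binom a (suc k)) ⟩
  (a - s) * (s * binom a (suc k))                    ≡⟨ cong ((a - s) *_) (trans (binom-suc a k) (binom-absorb a k)) ⟩
  (a - s) * (a * binom (a - 1ℚ) k)                   ≡⟨ cong (λ t → (a - t) * (a * binom (a - 1ℚ) k)) (fromℕ-suc k) ⟩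
  (a - (fromℕ k + 1ℚ)) * (a * binom (a - 1ℚ) k)      ≡⟨ solve 3 (λ a k b → (a :- (k :+ con 1ℚ)) :* (a :* b) := a :* ((a :- con 1ℚ :- k) :* b)) refl a (fromℕ k) (binom (a - 1ℚ) k) ⟩
  a * ((a - 1ℚ - fromℕ k) * binom (a - 1ℚ) k)        ≡⟨ cong (a *_) (binom-suc (a - 1ℚ) k) ⟨
  a * (s * binom (a - 1ℚ) (suc k))                   ≡⟨ swap a s (binom (a - 1ℚ) (suc k)) ⟩
  s * (a * binom (a - 1ℚ) (suc k))                   ∎)
  where
  s = fromℕ (suc k)
  swap : ∀ a b c → a * (b * c) ≡ b * (a * c)
  swap = solve 3 (λ a b c → a :* (b :* c) := b :* (a :* c)) refl

binom-pascal : ∀ a k → binom a (suc k) ≡ binom (a - 1ℚ) (suc k) + binom (a - 1ℚ) k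
binom-pascal a k = *-cancelˡ-fromℕ (suc k) (begin
  s * binom a (suc k)                                              ≡⟨ trans (binom-suc a k) (binom-absorb a k) ⟩
  a * b                                                            ≡⟨ solve 3 (λ a b k → a :* b := (a :- con 1ℚ :- k) :* b :+ (k :+ con 1ℚ) :* b) refl a b (fromℕ k) ⟩
  (a - 1ℚ - fromℕ k) * b + (fromℕ k + 1ℚ) * b                      ≡⟨ cong₂ (λ t w → t + w * b) (sym (binom-suc (a - 1ℚ) k)) (sym (fromℕ-suc k)) ⟩
  s * binom (a - 1ℚ) (suc k) + s * b                               ≡⟨ *-distribˡ-+ s (binom (a - 1ℚ) (suc k)) b ⟨
  s * (binom (a - 1ℚ) (suc k) + b)                                 ∎)
  where
  s = fromℕ (suc k)
  b = binom (a - 1ℚ) k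

-- `P k a` takes one factor from `u k (a - 1ℚ)` and one from `u k a`. It is G(a)/a written without a
-- division, so it also makes sense at a = 0.
u P : ℕ → ℚ → ℚ
u k a = binom a k * binom (- 1ℚ - a) k
P k a = binom (a - 1ℚ) k * binom (- 1ℚ - a) k

binom²-suc : ∀ x y k → fromℕ (suc k) * (fromℕ (suc k) * (binom x (suc k) * binom y (suc k)))
  ≡ (x - fromℕ k) * (y - fromℕ k) * (binom x k * binom y k)
binom²-suc x y k = begin
  s * (s * (binom x (suc k) * binom y (suc k)))             ≡⟨ solve 3 (λ s b c → s :* (s :* (b :* c)) := s :* b :* (s :* c)) refl s (binom x (suc k)) (binom y (suc k)) ⟩
  s * binom x (suc k) * (s * binom y (suc k))               ≡⟨ cong₂ _*_ (binom-suc x k) (binom-suc y k) ⟩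
  (x - fromℕ k) * binom x k * ((y - fromℕ k) * binom y k)   ≡⟨ solve 4 (λ a b c d → a :* b :* (c :* d) := a :* c :* (b :* d)) refl (x - fromℕ k) (binom x k) (y - fromℕ k) (binom y k) ⟩
  (x - fromℕ k) * (y - fromℕ k) * (binom x k * binom y k)   ∎
  where s = fromℕ (suc k)

S₀ : ℕ → ℚ → ℚ
S₀ n a = sumQ (λ k → u k a) (suc n)

-- Pascal's rule expands the new terms on the left into 2x′y′ + (xy′ + x′y). In `cross` the
-- parameter a cancels and the mixed part becomes -2xy, which removes the value 2xy from the
-- induction hypothesis.
S₀-add : ∀ n a → S₀ n a + S₀ n (a - 1ℚ) ≡ fromℕ 2 * P n a
S₀-add zero a = refl
S₀-add (suc n) a = begin
  S₀ n a + u (suc n) a + (S₀ n (a - 1ℚ) + u (suc n) (a - 1ℚ))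
    ≡⟨ solve 4 (λ a b c d → a :+ b :+ (c :+ d) := (a :+ c) :+ (b :+ d)) refl (S₀ n a) (u (suc n) a) (S₀ n (a - 1ℚ)) (u (suc n) (a - 1ℚ)) ⟩
  (S₀ n a + S₀ n (a - 1ℚ)) + (u (suc n) a + u (suc n) (a - 1ℚ))
    ≡⟨ cong₂ _+_ (S₀-add n a) (cong₂ (λ s t → s * y′ + x′ * t) (binom-pascal a n)
         (trans (binom-pascal b n) (cong (λ c → binom c (suc n) + binom c n)
           (solve 1 (λ a → :- con 1ℚ :- (a :- con 1ℚ) :- con 1ℚ := :- con 1ℚ :- a) refl a)))) ⟩
  fromℕ 2 * (x * y) + ((x′ + x) * y′ + x′ * (y′ + y))
    ≡⟨ linear-combination 1ℚ cross (solve 4 (λ x y x′ y′ → con (fromℕ 2) :* (x :* y) :+ ((x′ :+ x) :* y′ :+ x′ :* (y′ :+ y))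
         := con (fromℕ 2) :* (x′ :* y′) :+ con 1ℚ :* (x :* y′ :+ x′ :* y :- (:- con (fromℕ 2)) :* (x :* y))) refl x y x′ y′) ⟩
  fromℕ 2 * (x′ * y′) ∎
  where
  b = - 1ℚ - (a - 1ℚ)
  s = fromℕ (suc n)
  x = binom (a - 1ℚ) n
  x′ = binom (a - 1ℚ) (suc n)
  y = binom (- 1ℚ - a) n
  y′ = binom (- 1ℚ - a) (suc n)
  cross : x * y′ + x′ * y ≡ - fromℕ 2 * (x * y)
  cross = *-cancelˡ-fromℕ (suc n) (begin
    s * (x * y′ + x′ * y)
      ≡⟨ solve 5 (λ s x y x′ y′ → s :* (x :* y′ :+ x′ :* y) := x :* (s :* y′) :+ s :* x′ :* y) refl s x y x′ y′ ⟩
    x * (s * y′) + s * x′ * y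
      ≡⟨ cong₂ (λ t w → x * t + w * y) (binom-suc (- 1ℚ - a) n) (binom-suc (a - 1ℚ) n) ⟩
    x * ((- 1ℚ - a - fromℕ n) * y) + (a - 1ℚ - fromℕ n) * x * y
      ≡⟨ solve 4 (λ x y a k → x :* ((:- con 1ℚ :- a :- k) :* y) :+ (a :- con 1ℚ :- k) :* x :* y
           := (k :+ con 1ℚ) :* ((:- con (fromℕ 2)) :* (x :* y))) refl x y a (fromℕ n) ⟩
    (fromℕ n + 1ℚ) * (- fromℕ 2 * (x * y))
      ≡⟨ cong (_* (- fromℕ 2 * (x * y))) (fromℕ-suc n) ⟨
    s * (- fromℕ 2 * (x * y)) ∎)

S₁ : ℕ → ℚ → ℚ
S₁ n a = sumQ (λ k → fromℕ k * binom a k * binom (- 1ℚ - a) k) (suc n)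

-- Telescoping: a(a+1) u_k = k u_k + k² u_k - (k+1)² u_{k+1}.
S₁-telescope : ∀ n a → S₁ n a ≡ a * (a + 1ℚ) * S₀ n a + (fromℕ n - a) * (fromℕ n + 1ℚ + a) * u n a
S₁-telescope zero a = solve 1 (λ a → con 0ℚ :+ con 0ℚ :* con 1ℚ :* con 1ℚ
  := a :* (a :+ con 1ℚ) :* (con 0ℚ :+ con 1ℚ) :+ (con 0ℚ :- a) :* (con 0ℚ :+ con 1ℚ :+ a) :* con 1ℚ) refl a
S₁-telescope (suc n) a = trans
  (cong₂ _+_ (S₁-telescope n a) (cong (λ s → s * binom a (suc n) * binom (- 1ℚ - a) (suc n)) (fromℕ-suc n)))
  (trans (linear-combination (- 1ℚ) (trans (cong (λ s → s * (s * u (suc n) a)) (sym (fromℕ-suc n))) (binom²-suc a (- 1ℚ - a) n))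
    (solve 6 (λ a k S v x y → let s = k :+ con 1ℚ in
      a :* (a :+ con 1ℚ) :* S :+ (k :- a) :* (k :+ con 1ℚ :+ a) :* v :+ s :* x :* y
      := a :* (a :+ con 1ℚ) :* (S :+ x :* y) :+ (s :- a) :* (s :+ con 1ℚ :+ a) :* (x :* y)
         :+ (:- con 1ℚ) :* (s :* (s :* (x :* y)) :- (a :- k) :* (:- con 1ℚ :- a :- k) :* v)) refl
      a (fromℕ n) (S₀ n a) (u n a) (binom a (suc n)) (binom (- 1ℚ - a) (suc n))))
  (cong (λ s → a * (a + 1ℚ) * (S₀ n a + u (suc n) a) + (s - a) * (s + 1ℚ + a) * u (suc n) a) (sym (fromℕ-suc n))))

-- Absorption, (a - n) C(a,n) = a C(a-1,n), turns the boundary term of the telescoped sum into a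
-- multiple of `G n a`.
S₁-S₀ : ∀ n a → S₁ n a ≡ a * (a + 1ℚ) * S₀ n a - (fromℕ n + 1ℚ + a) * (a * P n a)
S₁-S₀ n a = trans (S₁-telescope n a)
  (linear-combination (- (fromℕ n + 1ℚ + a) * y) (binom-absorb a n)
    (solve 6 (λ a k S x x′ y → a :* (a :+ con 1ℚ) :* S :+ (k :- a) :* (k :+ con 1ℚ :+ a) :* (x :* y)
       := a :* (a :+ con 1ℚ) :* S :- (k :+ con 1ℚ :+ a) :* (a :* (x′ :* y))
         :+ (:- (k :+ con 1ℚ :+ a)) :* y :* ((a :- k) :* x :- a :* x′)) refl
      a (fromℕ n) (S₀ n a) (binom a n) (binom (a - 1ℚ) n) y))
  where y = binom (- 1ℚ - a) n

S₁-reflect : ∀ n a → S₁ n a ≡ S₁ n (- 1ℚ - a)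
S₁-reflect n a = sumQ-cong (suc n) (λ k _ → trans
  (solve 3 (λ k x y → k :* x :* y := k :* y :* x) refl (fromℕ k) (binom a k) (binom (- 1ℚ - a) k))
  (cong (λ b → fromℕ k * binom (- 1ℚ - a) k * binom b k) (solve 1 (λ a → a := :- con 1ℚ :- (:- con 1ℚ :- a)) refl a)))

-- G n a = a ∏_{k=1}^n (1 - a²/k²).
G : ℕ → ℚ → ℚ
G n a = a * P n a

G-suc : ∀ n a → fromℕ (suc n) * (fromℕ (suc n) * G (suc n) a) ≡ (fromℕ (suc n) * fromℕ (suc n) - a * a) * G n a
G-suc n a = begin
  s * (s * (a * P (suc n) a))                                ≡⟨ solve 3 (λ s a q → s :* (s :* (a :* q)) := a :* (s :* (s :* q))) refl s a (P (suc n) a) ⟩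
  a * (s * (s * P (suc n) a))                                ≡⟨ cong (a *_) (binom²-suc (a - 1ℚ) (- 1ℚ - a) n) ⟩
  a * ((a - 1ℚ - fromℕ n) * (- 1ℚ - a - fromℕ n) * P n a)    ≡⟨ solve 3 (λ a k q → a :* ((a :- con 1ℚ :- k) :* (:- con 1ℚ :- a :- k) :* q)
                                                                   := ((k :+ con 1ℚ) :* (k :+ con 1ℚ) :- a :* a) :* (a :* q)) refl a (fromℕ n) (P n a) ⟩
  ((fromℕ n + 1ℚ) * (fromℕ n + 1ℚ) - a * a) * G n a          ≡⟨ cong (λ t → (t * t - a * a) * G n a) (fromℕ-suc n) ⟨
  (s * s - a * a) * G n a                                    ∎
  where s = fromℕ (suc n)

G-shift : ∀ n a → (a - fromℕ n) * G n (a + 1ℚ) ≡ (a + fromℕ n + 1ℚ) * G n a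
G-shift n a = begin
  (a - fromℕ n) * ((a + 1ℚ) * (binom (a + 1ℚ - 1ℚ) n * binom (- 1ℚ - (a + 1ℚ)) n))
    ≡⟨ cong₂ (λ s t → (a - fromℕ n) * ((a + 1ℚ) * (binom s n * binom t n)))
         (solve 1 (λ a → a :+ con 1ℚ :- con 1ℚ := a) refl a)
         (solve 1 (λ a → :- con 1ℚ :- (a :+ con 1ℚ) := :- con 1ℚ :- a :- con 1ℚ) refl a) ⟩
  (a - fromℕ n) * ((a + 1ℚ) * (x * y′))
    -- Absorption is used twice: a - n turns C(a,n) into a C(a-1,n), and (a+1) C(-2-a,n) becomes
    -- (a+n+1) C(-1-a,n).
    ≡⟨ linear-combination₂ ((a + 1ℚ) * y′) (a * x′) (binom-absorb a n) (binom-absorb (- 1ℚ - a) n)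
         (solve 6 (λ a k x x′ y y′ → (a :- k) :* ((a :+ con 1ℚ) :* (x :* y′))
            := (a :+ k :+ con 1ℚ) :* (a :* (x′ :* y))
              :+ (a :+ con 1ℚ) :* y′ :* ((a :- k) :* x :- a :* x′)
              :+ a :* x′ :* ((:- con 1ℚ :- a :- k) :* y :- (:- con 1ℚ :- a) :* y′)) refl
            a (fromℕ n) x x′ y y′) ⟩
  (a + fromℕ n + 1ℚ) * G n a ∎
  where
  x = binom a n
  x′ = binom (a - 1ℚ) n
  y = binom (- 1ℚ - a) n
  y′ = binom (- 1ℚ - a - 1ℚ) n

binom-vanish : ∀ j n → j < n → binom (fromℕ j) n ≡ 0ℚ
binom-vanish j n j<n = trans (cong (_* invℕ (n !)) (vanish n j<n)) (*-zeroˡ (invℕ (n !)))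
  where
  f : ℕ → ℚ
  f i = fromℕ j - fromℕ i
  vanish : ∀ n → j < n → prodQ f n ≡ 0ℚ
  vanish (suc n) (s≤s j≤n) with ℕ.m≤n⇒m<n∨m≡n j≤n
  ... | inj₁ j<n = trans (cong (_* f n) (vanish n j<n)) (*-zeroˡ (f n))
  ... | inj₂ refl = trans (cong (prodQ f j *_) (+-inverseʳ (fromℕ j))) (*-zeroʳ (prodQ f j))

-- At 0 only the term k = 0 survives. From m to m + 1 ≤ n the right-hand side of `S₀-add` vanishes,
-- as C(m,n) = 0, so the value just changes sign.
S₀-fromℕ : ∀ n m → m ≤ n → S₀ n (fromℕ m) ≡ (- 1ℚ) ^ℚ m
S₀-fromℕ n zero _ = trans (sumQ-head (λ k → u k 0ℚ) n)
  (cong (1ℚ +_) (sumQ-zero n (λ i _ → trans (cong (_* binom (- 1ℚ - 0ℚ) (suc i)) (binom-vanish 0 (suc i) (s≤s z≤n)))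
    (*-zeroˡ (binom (- 1ℚ - 0ℚ) (suc i))))))
S₀-fromℕ n (suc m) m<n = begin
  S₀ n x                                       ≡⟨ solve 2 (λ s t → s := (s :+ t) :- t) refl (S₀ n x) (S₀ n (x - 1ℚ)) ⟩
  S₀ n x + S₀ n (x - 1ℚ) - S₀ n (x - 1ℚ)       ≡⟨ cong₂ _-_ (S₀-add n x) (trans (cong (S₀ n) x-1≡m) (S₀-fromℕ n m (ℕ.<⇒≤ m<n))) ⟩
  fromℕ 2 * P n x - (- 1ℚ) ^ℚ m                ≡⟨ cong (λ b → fromℕ 2 * (b * binom (- 1ℚ - x) n) - (- 1ℚ) ^ℚ m) (trans (cong (λ y → binom y n) x-1≡m) (binom-vanish m n m<n)) ⟩
  fromℕ 2 * (0ℚ * binom (- 1ℚ - x) n) - (- 1ℚ) ^ℚ m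
    ≡⟨ solve 2 (λ b s → con (fromℕ 2) :* (con 0ℚ :* b) :- s := (:- con 1ℚ) :* s) refl (binom (- 1ℚ - x) n) ((- 1ℚ) ^ℚ m) ⟩
  - 1ℚ * (- 1ℚ) ^ℚ m ∎
  where
  x = fromℕ (suc m)
  x-1≡m : x - 1ℚ ≡ fromℕ m
  x-1≡m = trans (cong (_- 1ℚ) (fromℕ-suc m)) (solve 1 (λ m → m :+ con 1ℚ :- con 1ℚ := m) refl (fromℕ m))

-- Ingredients of Fermat's theorem: binomial expansion and divisibility of C(p,k)

Ψ-1 : ∀ m z c → Ψ m z (λ _ → c) ≡ c * (z + 1ℚ) ^ℚ m
Ψ-1 zero z c = sym (*-identityʳ c)
Ψ-1 (suc m) z c = trans (Ψ-1 m z (z * c + c))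
  (solve 3 (λ z c y → (z :* c :+ c) :* y := c :* ((z :+ con 1ℚ) :* y)) refl z c ((z + 1ℚ) ^ℚ m))

prime∤! : ∀ {p} → Prime p → ∀ k → k < p → ¬ p ∣ k !
prime∤! prime-p zero _ p∣1 = ¬prime[1] (subst Prime (∣1⇒≡1 p∣1) prime-p)
prime∤! prime-p (suc k) k<p p∣! with euclidsLemma (suc k) (k !) prime-p p∣!
... | inj₁ p∣k = ℕ.<⇒≱ k<p (∣⇒≤ p∣k)
... | inj₂ p∣k! = prime∤! prime-p k (ℕ.<⇒≤ k<p) p∣k!

-- p divides p! = C(p,k+1) (k+1)! (p-k-1)!, but neither factorial on the right, both being of
-- numbers below p.
prime∣C : ∀ {p} → Prime p → ∀ k → suc k < p → p ∣ p C suc k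
prime∣C {p} prime-p k k<p with euclidsLemma (p C suc k) (suc k ! ℕ.* (p ∸ suc k) !) prime-p (subst (p ∣_) (sym C*!≡!) (p∣p! p (ℕ.<-trans (s≤s z≤n) k<p)))
  where
  instance _ = ℕ._!*_!≢0 (suc k) (p ∸ suc k)
  C*!≡! : (p C suc k) ℕ.* (suc k ! ℕ.* (p ∸ suc k) !) ≡ p !
  C*!≡! = trans (cong (ℕ._* (suc k ! ℕ.* (p ∸ suc k) !)) (nCk≡n!/k![n-k]! (ℕ.<⇒≤ k<p))) (ℕ.m/n*n≡m (k![n∸k]!∣n! (ℕ.<⇒≤ k<p)))
  p∣p! : ∀ n → 0 < n → n ∣ n !
  p∣p! (suc n) _ = m∣m*n (n !)
... | inj₁ p∣C = p∣C
... | inj₂ p∣! with euclidsLemma (suc k !) ((p ∸ suc k) !) prime-p p∣!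
... | inj₁ p∣k! = contradiction p∣k! (prime∤! prime-p (suc k) k<p)
... | inj₂ p∣[p∸k]! = contradiction p∣[p∸k]! (prime∤! prime-p (p ∸ suc k) (ℕ.∸-monoʳ-< {p} {suc k} {0} (s≤s z≤n) (ℕ.<⇒≤ k<p)))

-- Congruences in ℤ₍ₚ₎

module Localisation (p : ℕ) (prime-p : Prime p) where

  -- Div m x says x ∈ pᵐ ℤ₍ₚ₎; unlike InZp it allows unreduced fractions, which makes closure properties direct.
  record Div (m : ℕ) (x : ℚ) : Set where
    constructor div
    field
      den : ℤ
      num : ℤ
      den-unit : ¬ p ∣ ∣ den ∣
      scaled : x * ι den ≡ fromℕ (p ℕ.^ m) * ι num

  p∤1 : ¬ p ∣ 1
  p∤1 p∣1 = ¬prime[1] (subst Prime (∣1⇒≡1 p∣1) prime-p)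

  unit-* : ∀ i j → ¬ p ∣ ∣ i ∣ → ¬ p ∣ ∣ j ∣ → ¬ p ∣ ∣ i ℤ.* j ∣
  unit-* i j p∤i p∤j p∣ij with euclidsLemma ∣ i ∣ ∣ j ∣ prime-p (subst (p ∣_) (ℤ.abs-* i j) p∣ij)
  ... | inj₁ p∣i = p∤i p∣i
  ... | inj₂ p∣j = p∤j p∣j

  div-+ : ∀ {m x y} → Div m x → Div m y → Div m (x + y)
  div-+ {m} {x} {y} (div d k p∤d e) (div d′ k′ p∤d′ e′) =
    div (d ℤ.* d′) (k ℤ.* d′ ℤ.+ k′ ℤ.* d) (unit-* d d′ p∤d p∤d′) (begin
      (x + y) * ι (d ℤ.* d′)                     ≡⟨ cong ((x + y) *_) (ι-* d d′) ⟩
      (x + y) * (ι d * ι d′)                     ≡⟨ solve 4 (λ x y d d′ → (x :+ y) :* (d :* d′) := x :* d :* d′ :+ y :* d′ :* d) refl x y (ι d) (ι d′) ⟩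
      x * ι d * ι d′ + y * ι d′ * ι d            ≡⟨ cong₂ (λ s t → s * ι d′ + t * ι d) e e′ ⟩
      pᵐ * ι k * ι d′ + pᵐ * ι k′ * ι d            ≡⟨ solve 5 (λ pᵐ k k′ d d′ → pᵐ :* k :* d′ :+ pᵐ :* k′ :* d := pᵐ :* (k :* d′ :+ k′ :* d)) refl pᵐ (ι k) (ι k′) (ι d) (ι d′) ⟩
      pᵐ * (ι k * ι d′ + ι k′ * ι d)              ≡⟨ cong (pᵐ *_) (sym (trans (ι-+ (k ℤ.* d′) (k′ ℤ.* d)) (cong₂ _+_ (ι-* k d′) (ι-* k′ d)))) ⟩
      pᵐ * ι (k ℤ.* d′ ℤ.+ k′ ℤ.* d)              ∎)
    where pᵐ = fromℕ (p ℕ.^ m)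

  div-* : ∀ {m n x y} → Div m x → Div n y → Div (m ℕ.+ n) (x * y)
  div-* {m} {n} {x} {y} (div d k p∤d e) (div d′ k′ p∤d′ e′) =
    div (d ℤ.* d′) (k ℤ.* k′) (unit-* d d′ p∤d p∤d′) (begin
      x * y * ι (d ℤ.* d′)           ≡⟨ cong (x * y *_) (ι-* d d′) ⟩
      x * y * (ι d * ι d′)           ≡⟨ swap x y (ι d) (ι d′) ⟩
      (x * ι d) * (y * ι d′)         ≡⟨ cong₂ _*_ e e′ ⟩
      (pᵐ * ι k) * (pⁿ * ι k′)         ≡⟨ swap pᵐ (ι k) pⁿ (ι k′) ⟩
      (pᵐ * pⁿ) * (ι k * ι k′)         ≡⟨ cong₂ _*_ (sym (trans (cong fromℕ (ℕ.^-distribˡ-+-* p m n)) (fromℕ-* (p ℕ.^ m) (p ℕ.^ n)))) (sym (ι-* k k′)) ⟩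
      fromℕ (p ℕ.^ (m ℕ.+ n)) * ι (k ℤ.* k′) ∎)
    where
    pᵐ = fromℕ (p ℕ.^ m)
    pⁿ = fromℕ (p ℕ.^ n)
    swap : ∀ a b c d → a * b * (c * d) ≡ (a * c) * (b * d)
    swap = solve 4 (λ a b c d → a :* b :* (c :* d) := (a :* c) :* (b :* d)) refl

  integral : ∀ i → Div 0 (ι i)
  integral i = div (ℤ.+ 1) i p∤1 (*-comm (ι i) 1ℚ)

  div-fromℕ : ∀ m k → Div m (fromℕ (p ℕ.^ m) * ι k)
  div-fromℕ m k = div (ℤ.+ 1) k p∤1 (*-identityʳ _)

  div-p : Div 1 (fromℕ p)
  div-p = subst (Div 1) (trans (*-identityʳ _) (cong fromℕ (ℕ.*-identityʳ p))) (div-fromℕ 1 (ℤ.+ 1))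

  div-0 : ∀ {m} → Div m 0ℚ
  div-0 {m} = subst (Div m) (*-zeroʳ (fromℕ (p ℕ.^ m))) (div-fromℕ m (ℤ.+ 0))

  div-neg : ∀ {m x} → Div m x → Div m (- x)
  div-neg {m} {x} dx = subst (Div m) (solve 1 (λ x → :- con 1ℚ :* x := :- x) refl x) (div-* (integral ℤ.-1ℤ) dx)

  div-minus : ∀ {m x y} → Div m x → Div m y → Div m (x - y)
  div-minus dx dy = div-+ dx (div-neg dy)

  div-weaken : ∀ {m x} → Div (suc m) x → Div m x
  div-weaken {m} {x} (div d k p∤d e) = div d (ℤ.+ p ℤ.* k) p∤d (trans e (begin
    fromℕ (p ℕ.* p ℕ.^ m) * ι k            ≡⟨ cong (_* ι k) (fromℕ-* p (p ℕ.^ m)) ⟩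
    fromℕ p * fromℕ (p ℕ.^ m) * ι k        ≡⟨ solve 3 (λ a b c → a :* b :* c := b :* (a :* c)) refl (fromℕ p) (fromℕ (p ℕ.^ m)) (ι k) ⟩
    fromℕ (p ℕ.^ m) * (fromℕ p * ι k)      ≡⟨ cong (fromℕ (p ℕ.^ m) *_) (sym (ι-* (ℤ.+ p) k)) ⟩
    fromℕ (p ℕ.^ m) * ι (ℤ.+ p ℤ.* k)        ∎))

  -- The numerator of a unit u is prime to p, so it can be moved into the denominator of x.
  div-cancel : ∀ {m u x} → Div 0 u → ¬ Div 1 u → Div m (u * x) → Div m x
  div-cancel {m} {u} {x} (div d z p∤d e) u-unit (div d′ k p∤d′ e′) =
    div (z ℤ.* d′) (d ℤ.* k) (unit-* z d′ p∤z p∤d′) (begin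
      x * ι (z ℤ.* d′)                ≡⟨ cong (x *_) (ι-* z d′) ⟩
      x * (ι z * ι d′)                ≡⟨ cong (λ s → x * (s * ι d′)) (sym (trans e (*-identityˡ (ι z)))) ⟩
      x * (u * ι d * ι d′)            ≡⟨ solve 4 (λ x u d d′ → x :* (u :* d :* d′) := d :* (u :* x :* d′)) refl x u (ι d) (ι d′) ⟩
      ι d * (u * x * ι d′)            ≡⟨ cong (ι d *_) e′ ⟩
      ι d * (pᵐ * ι k)                 ≡⟨ solve 3 (λ d pᵐ k → d :* (pᵐ :* k) := pᵐ :* (d :* k)) refl (ι d) pᵐ (ι k) ⟩
      pᵐ * (ι d * ι k)                 ≡⟨ cong (pᵐ *_) (sym (ι-* d k)) ⟩
      pᵐ * ι (d ℤ.* k)                 ∎)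
    where
    pᵐ = fromℕ (p ℕ.^ m)
    p∤z : ¬ p ∣ ∣ z ∣
    p∤z p∣z with ℤ.∣ᵤ⇒∣ {ℤ.+ p} {z} p∣z
    ... | ℤ.divides q z≡q*p = u-unit (div d q p∤d (begin
      u * ι d                   ≡⟨ trans e (*-identityˡ (ι z)) ⟩
      ι z                       ≡⟨ cong ι z≡q*p ⟩
      ι (q ℤ.* ℤ.+ p)             ≡⟨ ι-* q (ℤ.+ p) ⟩
      ι q * fromℕ p             ≡⟨ *-comm (ι q) (fromℕ p) ⟩
      fromℕ p * ι q             ≡⟨ cong (λ s → fromℕ s * ι q) (sym (ℕ.*-identityʳ p)) ⟩
      fromℕ (p ℕ.* 1) * ι q     ∎))

  div-1-fromℕ⇒∣ : ∀ k → Div 1 (fromℕ k) → p ∣ k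
  div-1-fromℕ⇒∣ k (div d z p∤d e) with euclidsLemma k ∣ d ∣ prime-p (divides ∣ z ∣ (begin
      k ℕ.* ∣ d ∣             ≡⟨ ℤ.abs-* (ℤ.+ k) d ⟨
      ∣ ℤ.+ k ℤ.* d ∣           ≡⟨ cong ∣_∣ (ι-injective (ℤ.+ k ℤ.* d) (ℤ.+ (p ℕ.* 1) ℤ.* z) (trans (ι-* (ℤ.+ k) d) (trans e (sym (ι-* (ℤ.+ (p ℕ.* 1)) z))))) ⟩
      ∣ ℤ.+ (p ℕ.* 1) ℤ.* z ∣   ≡⟨ ℤ.abs-* (ℤ.+ (p ℕ.* 1)) z ⟩
      (p ℕ.* 1) ℕ.* ∣ z ∣     ≡⟨ cong (ℕ._* ∣ z ∣) (ℕ.*-identityʳ p) ⟩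
      p ℕ.* ∣ z ∣             ≡⟨ ℕ.*-comm p ∣ z ∣ ⟩
      ∣ z ∣ ℕ.* p             ∎))
  ... | inj₁ p∣k = p∣k
  ... | inj₂ p∣d = contradiction p∣d p∤d

  fromℕ-unit : ∀ k .{{_ : ℕ.NonZero k}} → k < p → ¬ Div 1 (fromℕ k)
  fromℕ-unit k k<p dk = ℕ.<⇒≱ k<p (∣⇒≤ (div-1-fromℕ⇒∣ k dk))

  InZp⇒div : ∀ x → InZp p x → Div 0 x
  InZp⇒div x x∈Zp = div (↧ x) (↥ x) x∈Zp (trans (*-clear-denominator x) (sym (*-identityˡ _)))

  -- Cross-multiplying with the reduced form of x shows that if p divided the reduced denominator,
  -- it would divide the reduced numerator or `d`; lowest terms exclude the one, `p∤d` the other.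
  div⇒InZp : ∀ x → Div 0 x → InZp p x
  div⇒InZp x (div d k p∤d e) p∣↧x with euclidsLemma ∣ ↥ x ∣ ∣ d ∣ prime-p
      (subst (p ∣_) (ℤ.abs-* (↥ x) d) (subst (λ s → p ∣ ∣ s ∣)
        (sym (cross-multiply x d k (trans e (*-identityˡ _))))
        (subst (p ∣_) (sym (ℤ.abs-* k (↧ x))) (∣-trans p∣↧x (n∣m*n ∣ k ∣)))))
  ... | inj₂ p∣d = p∤d p∣d
  ... | inj₁ p∣↥x = coprime x p∣↥x p∣↧x
    where
    coprime : ∀ x → p ∣ ∣ ↥ x ∣ → ¬ p ∣ ↧ₙ x
    -- The coprimality proof stored in a rational is irrelevant, so a usable one is recomputed from
    -- the decision procedure.
    coprime (mkℚ n d c) p∣n p∣d = p∤1 (subst (p ∣_) (recompute (coprime? ∣ n ∣ (suc d)) c (p∣n , p∣d)) (divides 1 (sym (ℕ.*-identityˡ p))))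

  cong⇒div : ∀ {m} x y → Cong p m x y → Div m (x - y)
  cong⇒div {m} x y (z , z∈Zp , eq) = subst₂ Div (ℕ.+-identityʳ m) (sym eq)
    (div-* {m} {0} {fromℕ (p ℕ.^ m)} {z} (subst (Div m) (*-identityʳ (fromℕ (p ℕ.^ m))) (div-fromℕ m (ℤ.+ 1))) (InZp⇒div z z∈Zp))

  div⇒cong : ∀ {m} x y → Div m (x - y) → Cong p m x y
  div⇒cong {m} x y (div d k p∤d e) = z , div⇒InZp z (div d k p∤d (begin
      z * ι d                       ≡⟨ solve 3 (λ i w d → i :* w :* d := i :* (w :* d)) refl I w (ι d) ⟩
      I * (w * ι d)                 ≡⟨ cong (I *_) e ⟩
      I * (pᵐ * ι k)                 ≡⟨ *-assoc I pᵐ (ι k) ⟨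
      I * pᵐ * ι k                   ≡⟨ cong (_* ι k) (invℕ-inverse (p ℕ.^ m)) ⟩
      1ℚ * ι k                      ∎)) , (begin
      w                             ≡⟨ *-identityˡ w ⟨
      1ℚ * w                        ≡⟨ cong (_* w) (invℕ-inverse (p ℕ.^ m)) ⟨
      I * pᵐ * w                     ≡⟨ solve 3 (λ i pᵐ w → i :* pᵐ :* w := pᵐ :* (i :* w)) refl I pᵐ w ⟩
      pᵐ * z                         ∎)
    where
    instance
      _ = prime⇒nonZero prime-p
      _ = ℕ.m^n≢0 p m
    w = x - y
    I = invℕ (p ℕ.^ m)
    pᵐ = fromℕ (p ℕ.^ m)
    z = I * w

  by : ∀ {m x y} → x ≡ y → Div m y → Div m x
  by {m} x≡y = subst (Div m) (sym x≡y)

  div-*ˡ : ∀ {m x y} → Div 0 x → Div m y → Div m (x * y)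
  div-*ˡ = div-*

  div-*ʳ : ∀ {m x y} → Div m x → Div 0 y → Div m (x * y)
  div-*ʳ {m} {x} {y} dx dy = by (*-comm x y) (div-* dy dx)

  fromℕ-integral : ∀ k → Div 0 (fromℕ k)
  fromℕ-integral k = integral (ℤ.+ k)

  1-integral : Div 0 1ℚ
  1-integral = fromℕ-integral 1

  div-1⇒0 : ∀ {x} → Div 1 x → Div 0 x
  div-1⇒0 = div-weaken

  sumQ-div : ∀ {m} f n → (∀ i → i < n → Div m (f i)) → Div m (sumQ f n)
  sumQ-div f zero d = div-0
  sumQ-div f (suc n) d = div-+ (sumQ-div f n (λ i i<n → d i (ℕ.m<n⇒m<1+n i<n))) (d n (ℕ.n<1+n n))

  ^-integral : ∀ {x} k → Div 0 x → Div 0 (x ^ℚ k)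
  ^-integral zero dx = 1-integral
  ^-integral (suc k) dx = div-*ˡ dx (^-integral k dx)

  ^-cong : ∀ {m x y} k → Div 0 x → Div 0 y → Div m (x - y) → Div m (x ^ℚ k - y ^ℚ k)
  ^-cong zero _ _ _ = by (+-inverseʳ 1ℚ) div-0
  ^-cong {m} {x} {y} (suc k) dx dy dxy = by
    (solve 4 (λ x y s t → x :* s :- y :* t := x :* (s :- t) :+ (x :- y) :* t) refl x y (x ^ℚ k) (y ^ℚ k))
    (div-+ (div-*ˡ dx (^-cong k dx dy dxy)) (div-*ʳ dxy (^-integral k dy)))

  residue-integral : ∀ a r → Div 1 (a - fromℕ r) → Div 0 a
  residue-integral a r a≡r = by (solve 2 (λ a r → a := a :- r :+ r) refl a (fromℕ r))
    (div-+ (div-1⇒0 a≡r) (fromℕ-integral r))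

  unit-cong : ∀ {x y} → Div 1 (x - y) → ¬ Div 1 y → ¬ Div 1 x
  unit-cong {x} {y} x≡y y-unit dx = y-unit (by (solve 2 (λ x y → y := x :- (x :- y)) refl x y) (div-minus dx x≡y))

  -- Fermat's theorem for units with a natural residue

  fermat-ℕ : ∀ s → Div 1 (fromℕ s ^ℚ p - fromℕ s)
  fermat-ℕ zero = by (trans (cong (λ k → 0ℚ ^ℚ k - 0ℚ) p≡suc) (cong (_- 0ℚ) (*-zeroˡ (0ℚ ^ℚ ℕ.pred p)))) div-0
    where
    instance _ = prime⇒nonZero prime-p
    p≡suc : p ≡ suc (ℕ.pred p)
    p≡suc = sym (ℕ.suc-pred p)
  fermat-ℕ (suc s) = by
    (trans (cong (λ x → x ^ℚ p - x) (fromℕ-suc s)) (solve 3 (λ y w x → y :- (x :+ con 1ℚ) := (y :- w :- con 1ℚ) :+ (w :- x)) refl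
      ((x + 1ℚ) ^ℚ p) (x ^ℚ p) x))
    (div-+ (by (cong (λ y → y - x ^ℚ p - 1ℚ) expand) middle) (fermat-ℕ s))
    where
    instance _ = prime⇒nonZero prime-p
    x = fromℕ s
    q = ℕ.pred p
    suc-q : suc q ≡ p
    suc-q = ℕ.suc-pred p
    T : ℕ → ℚ
    T r = fromℕ (p C r) * x ^ℚ (p ∸ r) * 1ℚ
    expand : (x + 1ℚ) ^ℚ p ≡ T 0 + (sumQ (λ r → T (suc r)) q + T p)
    expand = begin
      (x + 1ℚ) ^ℚ p                                    ≡⟨ *-identityˡ ((x + 1ℚ) ^ℚ p) ⟨
      1ℚ * (x + 1ℚ) ^ℚ p                               ≡⟨ Ψ-1 p x 1ℚ ⟨
      Ψ p x (λ _ → 1ℚ)                                 ≡⟨ Ψ-binomial p x (λ _ → 1ℚ) ⟩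
      sumQ T (suc p)                                   ≡⟨ sumQ-head T p ⟩
      T 0 + sumQ (λ r → T (suc r)) p                   ≡⟨ cong (λ k → T 0 + sumQ (λ r → T (suc r)) k) (sym suc-q) ⟩
      T 0 + (sumQ (λ r → T (suc r)) q + T (suc q))     ≡⟨ cong (λ k → T 0 + (sumQ (λ r → T (suc r)) q + T k)) suc-q ⟩
      T 0 + (sumQ (λ r → T (suc r)) q + T p)           ∎
    T-0 : T 0 ≡ x ^ℚ p
    T-0 = trans (cong (λ c → fromℕ c * x ^ℚ p * 1ℚ) (nC0≡1 p)) (solve 1 (λ y → con 1ℚ :* y :* con 1ℚ := y) refl (x ^ℚ p))
    T-p : T p ≡ 1ℚ
    T-p = cong₂ (λ c k → fromℕ c * x ^ℚ k * 1ℚ) (nCn≡1 p) (ℕ.n∸n≡0 p)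
    -- The end terms x^p and 1 of the expansion cancel; every inner term carries a factor C(p,i+1)
    -- with 0 < i+1 < p.
    middle : Div 1 (T 0 + (sumQ (λ r → T (suc r)) q + T p) - x ^ℚ p - 1ℚ)
    middle = by (trans (cong₂ (λ a b → a + (sumQ (λ r → T (suc r)) q + b) - x ^ℚ p - 1ℚ) T-0 T-p)
        (solve 2 (λ a b → a :+ (b :+ con 1ℚ) :- a :- con 1ℚ := b) refl (x ^ℚ p) (sumQ (λ r → T (suc r)) q)))
      (sumQ-div (λ r → T (suc r)) q (λ i i<q → div-*ʳ (div-*ʳ (div-C i (subst (suc i <_) suc-q (s≤s i<q))) (^-integral (p ∸ suc i) (fromℕ-integral s))) 1-integral))
      where
      div-C : ∀ i → suc i < p → Div 1 (fromℕ (p C suc i))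
      div-C i i<p with prime∣C prime-p i i<p
      ... | divides k eq = by (trans (cong fromℕ eq) (fromℕ-* k p)) (div-*ˡ (fromℕ-integral k) div-p)

  -- y^p ≡ s^p ≡ s ≡ y (mod p), and the unit y cancels.
  fermat : ∀ {y} m s → p ≡ suc m → Div 1 (y - fromℕ s) → ¬ Div 1 y → Div 1 (y ^ℚ m - 1ℚ)
  fermat {y} m s p≡ y≡s y-unit = div-cancel dy y-unit (by
    (trans (solve 2 (λ y w → y :* (w :- con 1ℚ) := y :* w :- y) refl y (y ^ℚ m))
    (trans (cong (λ k → y ^ℚ k - y) (sym p≡))
    (solve 4 (λ y w s t → w :- y := (w :- t) :+ (t :- s) :- (y :- s)) refl y (y ^ℚ p) (fromℕ s) (fromℕ s ^ℚ p))))
    (div-minus (div-+ (^-cong p dy (fromℕ-integral s) y≡s) (fermat-ℕ s)) y≡s))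
    where dy = residue-integral y s y≡s

  -- Integrality and congruences for Euler numbers and binomial products

  eulerAux-integral : ∀ f n → Div 0 (eulerAux f n)
  eulerAux-integral zero n = 1-integral
  eulerAux-integral (suc f) zero = 1-integral
  eulerAux-integral (suc f) (suc n) = div-neg (sumQ-div _ (suc n ℕ./ 2)
    (λ j _ → div-*ˡ (fromℕ-integral (suc n C (2 ℕ.* suc j))) (eulerAux-integral f (suc n ∸ 2 ℕ.* suc j))))

  -- Modulo p the operator z + shift is the shift alone, and m shifts bring E_m to the front.
  Ψ-mod : ∀ m z E → Div 1 z → (∀ i → Div 0 (E i)) → Div 1 (Ψ m z E - E m)
  Ψ-mod zero z E dz dE = by (+-inverseʳ (E 0)) div-0
  Ψ-mod (suc m) z E dz dE = by
    (solve 4 (λ w z e e′ → w :- e′ := (w :- (z :* e :+ e′)) :+ z :* e) refl (Ψ (suc m) z E) z (E m) (E (suc m)))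
    (div-+ (Ψ-mod m z _ dz (λ i → div-+ (div-*ʳ (div-1⇒0 dz) (dE i)) (dE (suc i)))) (div-*ʳ dz (dE m)))

  -- `binom²-suc` and `G-suc` are free of denominators; this divides their squared factor away
  -- again, k + 1 < p being a unit.
  cancel-suc² : ∀ {m x} k → suc k < p → Div m (fromℕ (suc k) * (fromℕ (suc k) * x)) → Div m x
  cancel-suc² {m} k k<p d = cancel (cancel d)
    where
    cancel : ∀ {x} → Div m (fromℕ (suc k) * x) → Div m x
    cancel = div-cancel (fromℕ-integral (suc k)) (fromℕ-unit (suc k) k<p)

  u-integral : ∀ {a} k → k < p → Div 0 a → Div 0 (u k a)
  u-integral zero _ _ = 1-integral
  u-integral {a} (suc k) k<p da = cancel-suc² k k<p (by (binom²-suc a (- 1ℚ - a) k)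
    (div-*ˡ (div-*ˡ (div-minus da dk) (div-minus (div-minus (div-neg 1-integral) da) dk)) (u-integral k (ℕ.<⇒≤ k<p) da)))
    where dk = fromℕ-integral k

  -- u k a is a polynomial in a (a + 1).
  u-cong : ∀ {m a b} k → k < p → Div 0 a → Div 0 b → Div m (a * (a + 1ℚ) - b * (b + 1ℚ)) → Div m (u k a - u k b)
  u-cong zero _ _ _ _ = by (+-inverseʳ (1ℚ * 1ℚ)) div-0
  u-cong {m} {a} {b} (suc k) k<p da db a≡b = cancel-suc² k k<p (by
    (trans (solve 3 (λ s x y → s :* (s :* (x :- y)) := s :* (s :* x) :- s :* (s :* y)) refl (fromℕ (suc k)) (u (suc k) a) (u (suc k) b))
    (trans (cong₂ _-_ (binom²-suc a (- 1ℚ - a) k) (binom²-suc b (- 1ℚ - b) k))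
    (solve 5 (λ a b k x y → (a :- k) :* (:- con 1ℚ :- a :- k) :* x :- (b :- k) :* (:- con 1ℚ :- b :- k) :* y
       := (a :- k) :* (:- con 1ℚ :- a :- k) :* (x :- y) :- (a :* (a :+ con 1ℚ) :- b :* (b :+ con 1ℚ)) :* y) refl
       a b (fromℕ k) (u k a) (u k b))))
    (div-minus (div-*ˡ (div-*ˡ (div-minus da dk) (div-minus (div-minus (div-neg 1-integral) da) dk)) (u-cong k (ℕ.<⇒≤ k<p) da db a≡b))
      (div-*ʳ a≡b (u-integral k (ℕ.<⇒≤ k<p) db))))
    where dk = fromℕ-integral k

  S₀-cong : ∀ {m} a b n → n < p → Div 0 a → Div 0 b → Div m (a * (a + 1ℚ) - b * (b + 1ℚ)) → Div m (S₀ n a - S₀ n b)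
  S₀-cong {m} a b n n<p da db a≡b = by
    (trans (solve 2 (λ s t → s :- t := s :+ :- con 1ℚ :* t) refl (S₀ n a) (S₀ n b)) (sym (lem (suc n))))
    (sumQ-div (λ k → u k a - u k b) (suc n) (λ k k<n → u-cong k (ℕ.<-≤-trans k<n n<p) da db a≡b))
    where
    lem : ∀ n → sumQ (λ k → u k a - u k b) n ≡ sumQ (λ k → u k a) n + - 1ℚ * sumQ (λ k → u k b) n
    lem zero = refl
    lem (suc n) = trans (cong (_+ (u n a - u n b)) (lem n))
      (solve 4 (λ s t x y → s :+ :- con 1ℚ :* t :+ (x :- y) := s :+ x :+ :- con 1ℚ :* (t :+ y)) refl
        (sumQ (λ k → u k a) n) (sumQ (λ k → u k b) n) (u n a) (u n b))

  -- Each factor 1 - a²/i² of `G` is 1 modulo p², as p divides a.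
  G-zero : ∀ {a} k → k < p → Div 1 a → Div 2 (G k a - a)
  G-zero {a} zero _ da = by (solve 1 (λ a → a :* (con 1ℚ :* con 1ℚ) :- a := con 0ℚ) refl a) div-0
  G-zero {a} (suc k) k<p da = cancel-suc² k k<p (by
    (trans (solve 3 (λ s g a → s :* (s :* (g :- a)) := s :* (s :* g) :- s :* s :* a) refl s (G (suc k) a) a)
    (trans (cong (_- s * s * a) (G-suc k a))
    (solve 3 (λ s g a → (s :* s :- a :* a) :* g :- s :* s :* a := (s :* s :- a :* a) :* (g :- a) :- a :* a :* a) refl s (G k a) a)))
    (div-minus (div-*ˡ (div-minus (div-*ˡ ds ds) (div-*ˡ (div-1⇒0 da) (div-1⇒0 da))) (G-zero k (ℕ.<⇒≤ k<p) da))
      (div-*ʳ (div-* da da) (div-1⇒0 da))))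
    where
    s = fromℕ (suc k)
    ds = fromℕ-integral (suc k)

-- Congruences modulo p² for p = 2n + 1

module OddPrime (p : ℕ) (prime-p : Prime p) (n′ : ℕ) (p≡1+2n : p ≡ suc (suc n′ ℕ.* 2)) where
  open Localisation p prime-p

  -- `m` is p - 2 in the visibly odd form needed by `euler-odd` and `eulerPoly-reflect`; by
  -- computation `p≡1+2n` also reads `p ≡ suc (suc m)`, the form used with `fermat`.
  n m : ℕ
  n = suc n′
  m = suc (n′ ℕ.* 2)

  T : ℚ → ℚ
  T a = eulerPoly m (- a)

  n<p : n < p
  n<p = subst (n <_) (sym p≡1+2n) (s≤s (ℕ.m≤m*n n 2))

  p≡2n+1 : fromℕ p ≡ fromℕ n * fromℕ 2 + 1ℚ
  p≡2n+1 = trans (cong fromℕ p≡1+2n) (trans (fromℕ-suc (n ℕ.* 2)) (cong (_+ 1ℚ) (fromℕ-* n 2)))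

  div-2n+1 : Div 1 (fromℕ n * fromℕ 2 + 1ℚ)
  div-2n+1 = by (sym p≡2n+1) div-p

  2-unit : ¬ Div 1 (fromℕ 2)
  2-unit = fromℕ-unit 2 (subst (2 <_) (sym p≡1+2n) (s≤s (s≤s (s≤s z≤n))))

  2^-unit : ∀ k → ¬ Div 1 (fromℕ (2 ℕ.^ k))
  2^-unit zero d = fromℕ-unit 1 (ℕ.≤-<-trans (s≤s z≤n) n<p) d
  2^-unit (suc k) d = 2^-unit k (div-cancel (fromℕ-integral 2) 2-unit (by (sym (fromℕ-* 2 (2 ℕ.^ k))) d))

  -- For b = a - 1 ≡ r, `G-shift` writes (b-n) times the new error as (b+n+1) times the old error
  -- plus (2n+1)(b-r). The latter is p times a multiple of p, and b - n is a unit because 0 < n - r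
  -- < p.
  G-mod : ∀ r a → r ≤ n → Div 1 (a - fromℕ r) → Div 2 (G n a - (a - fromℕ r))
  G-mod zero a _ a≡0 = by (cong (λ x → G n a - x) a-0≡a) (G-zero n n<p (by (sym a-0≡a) a≡0))
    where
    a-0≡a : a - 0ℚ ≡ a
    a-0≡a = solve 1 (λ a → a :- con 0ℚ := a) refl a
  G-mod (suc r) a r<n a≡r+1 = div-cancel b-n-integral b-n-unit (by
    (begin
      (b - fromℕ n) * (G n a - (a - fromℕ (suc r)))
        ≡⟨ cong₂ (λ x s → (b - fromℕ n) * (G n x - (a - s)))
             (solve 1 (λ a → a := a :- con 1ℚ :+ con 1ℚ) refl a) (fromℕ-suc r) ⟩
      (b - fromℕ n) * (G n (b + 1ℚ) - (a - (fromℕ r + 1ℚ)))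
        ≡⟨ linear-combination 1ℚ (G-shift n b) (solve 5 (λ a n r g g′ → let b = a :- con 1ℚ in
             (b :- n) :* (g′ :- (a :- (r :+ con 1ℚ)))
             := (b :+ n :+ con 1ℚ) :* (g :- (b :- r)) :+ (n :* con (fromℕ 2) :+ con 1ℚ) :* (b :- r)
                :+ con 1ℚ :* ((b :- n) :* g′ :- (b :+ n :+ con 1ℚ) :* g)) refl
             a (fromℕ n) (fromℕ r) (G n b) (G n (b + 1ℚ))) ⟩
      (b + fromℕ n + 1ℚ) * (G n b - (b - fromℕ r)) + (fromℕ n * fromℕ 2 + 1ℚ) * (b - fromℕ r) ∎)
    (div-+ (div-*ˡ (div-+ (div-+ b-integral (fromℕ-integral n)) 1-integral) (G-mod r b (ℕ.<⇒≤ r<n) b≡r))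
      (div-* div-2n+1 b≡r)))
    where
    b = a - 1ℚ
    b≡r : Div 1 (b - fromℕ r)
    b≡r = by (trans (solve 2 (λ a r → a :- con 1ℚ :- r := a :- (r :+ con 1ℚ)) refl a (fromℕ r))
      (cong (λ x → a - x) (sym (fromℕ-suc r)))) a≡r+1
    b-integral : Div 0 b
    b-integral = residue-integral b r b≡r
    b-n-integral : Div 0 (b - fromℕ n)
    b-n-integral = div-minus b-integral (fromℕ-integral n)
    b-n-unit : ¬ Div 1 (b - fromℕ n)
    b-n-unit d = fromℕ-unit (n ∸ r) {{ℕ.>-nonZero (ℕ.m<n⇒0<n∸m r<n)}} (ℕ.≤-<-trans (ℕ.m∸n≤m n r) n<p)
      (by (trans (solve 3 (λ b r x → x := b :- r :- (b :- (x :+ r))) refl b (fromℕ r) (fromℕ (n ∸ r)))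
        (cong (λ x → b - fromℕ r - (b - x)) (trans (sym (fromℕ-+ (n ∸ r) r)) (cong fromℕ (ℕ.m∸n+n≡m (ℕ.<⇒≤ r<n))))))
      (div-minus b≡r d))

  -- The error in the predicted value of `S₀`. Under (r, a) ↦ (r+1, a+1) the sign alternates and a -
  -- r is fixed, so adding two consecutive errors brings in both first-order recurrences at once.
  X : ℕ → ℚ → ℚ
  X r a = S₀ n a - (- 1ℚ) ^ℚ r + (a - fromℕ r) * T a

  X-base : ∀ a → Div 1 (a - fromℕ n) → Div 2 (X n a)
  X-base a a≡n = div-+
    (by (cong (λ s → S₀ n a - s) (sym (S₀-fromℕ n n ℕ.≤-refl)))
      (S₀-cong a (fromℕ n) n n<p (residue-integral a n a≡n) (fromℕ-integral n) (by
        (solve 2 (λ a n → a :* (a :+ con 1ℚ) :- n :* (n :+ con 1ℚ) := (a :- n) :* ((a :- n) :+ (n :* con (fromℕ 2) :+ con 1ℚ))) refl a (fromℕ n))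
        (div-* a≡n (div-+ a≡n div-2n+1)))))
    -- One factor p comes from a - n, the other from `T a`. The latter is checked after
    -- multiplication by the unit 2^m, where `Ψ-mod` leaves only E_m.
    (div-* a≡n (div-cancel (fromℕ-integral (2 ℕ.^ m)) (2^-unit m) (by
      (trans (eulerPoly-Ψ m (- a)) (trans (solve 1 (λ s → s := s :- con 0ℚ) refl (Ψ m z euler)) (cong (λ e → Ψ m z euler - e) (sym (euler-odd n′)))))
      (Ψ-mod m z euler dz (λ i → eulerAux-integral (suc i) i)))))
    where
    z = fromℕ 2 * - a - 1ℚ
    dz : Div 1 z
    dz = by (solve 2 (λ a n → con (fromℕ 2) :* (:- a) :- con 1ℚ := :- (con (fromℕ 2) :* (a :- n)) :- (n :* con (fromℕ 2) :+ con 1ℚ)) refl a (fromℕ n))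
      (div-minus (div-neg (div-*ˡ (fromℕ-integral 2) a≡n)) div-2n+1)

  -- The sum of the two errors is 2P(b) + 2(b-s)(-b)^{p-2}. Multiplied by the unit b it becomes
  -- 2G(b) - 2(b-s)(-b)^{p-1}, and modulo p² both parts equal 2(b-s).
  X-step : ∀ r a → r < n → Div 1 (a - fromℕ r) → Div 2 (X (suc r) (a + 1ℚ)) → Div 2 (X r a)
  X-step r a r<n a≡r dX = by (solve 2 (λ x y → x := (y :+ x) :- y) refl (X r a) (X s b)) (div-minus sum≡0 dX)
    where
    b = a + 1ℚ
    s = suc r
    w = (- b) ^ℚ m
    s<p : s < p
    s<p = ℕ.≤-<-trans r<n n<p
    b≡s : Div 1 (b - fromℕ s)
    b≡s = by (trans (cong (λ x → b - x) (fromℕ-suc r)) (solve 2 (λ a r → a :+ con 1ℚ :- (r :+ con 1ℚ) := a :- r) refl a (fromℕ r))) a≡r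
    b-unit : ¬ Div 1 b
    b-unit = unit-cong b≡s (fromℕ-unit s s<p)
    -b-unit : ¬ Div 1 (- b)
    -b-unit d = b-unit (by (solve 1 (λ b → b := :- (:- b)) refl b) (div-neg d))
    -- `fermat` asks for a natural number in the residue class, so -s is represented by p - s.
    -b≡p-s : Div 1 (- b - fromℕ (p ∸ s))
    -b≡p-s = by (trans (solve 3 (λ b s x → :- b :- x := :- (b :- s) :- (x :+ s)) refl b (fromℕ s) (fromℕ (p ∸ s)))
      (cong (λ x → - (b - fromℕ s) - x) (trans (sym (fromℕ-+ (p ∸ s) s)) (cong fromℕ (ℕ.m∸n+n≡m (ℕ.<⇒≤ s<p))))))
      (div-minus (div-neg b≡s) div-p)
    a≡b-1 : a ≡ b - 1ℚ
    a≡b-1 = solve 1 (λ a → a := a :+ con 1ℚ :- con 1ℚ) refl a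
    T-add : T b + T a ≡ fromℕ 2 * w
    T-add = trans (cong (λ x → T b + eulerPoly m x) (solve 1 (λ a → :- a := :- (a :+ con 1ℚ) :+ con 1ℚ) refl a)) (eulerPoly-add m (- b))
    S-add : S₀ n b + S₀ n a ≡ fromℕ 2 * P n b
    S-add = trans (cong (λ x → S₀ n b + S₀ n x) a≡b-1) (S₀-add n b)
    X-add : X s b + X r a ≡ fromℕ 2 * P n b + (b - fromℕ s) * (fromℕ 2 * w)
    X-add = trans (cong (λ t → S₀ n b - - 1ℚ * ε + (b - t) * T b + X r a) (fromℕ-suc r))
      (trans (linear-combination₂ 1ℚ (a - fromℕ r) S-add T-add
        (solve 9 (λ a r e sb sa tb ta q w → sb :- (:- con 1ℚ) :* e :+ (a :+ con 1ℚ :- (r :+ con 1ℚ)) :* tb :+ (sa :- e :+ (a :- r) :* ta)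
          := con (fromℕ 2) :* q :+ (a :+ con 1ℚ :- (r :+ con 1ℚ)) :* (con (fromℕ 2) :* w)
             :+ con 1ℚ :* (sb :+ sa :- con (fromℕ 2) :* q) :+ (a :- r) :* (tb :+ ta :- con (fromℕ 2) :* w)) refl
          a (fromℕ r) ε (S₀ n b) (S₀ n a) (T b) (T a) (P n b) w))
      (cong (λ t → fromℕ 2 * P n b + (b - t) * (fromℕ 2 * w)) (sym (fromℕ-suc r))))
      where ε = (- 1ℚ) ^ℚ r
    sum≡0 : Div 2 (X s b + X r a)
    sum≡0 = div-cancel (residue-integral b s b≡s) b-unit (by
      (trans (cong (b *_) X-add)
      (solve 4 (λ b s q w → b :* (con (fromℕ 2) :* q :+ (b :- s) :* (con (fromℕ 2) :* w))
         := con (fromℕ 2) :* (b :* q :- (b :- s)) :- con (fromℕ 2) :* ((b :- s) :* ((:- b) :* w :- con 1ℚ))) refl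
         b (fromℕ s) (P n b) w))
      (div-minus (div-*ˡ (fromℕ-integral 2) (G-mod s b r<n b≡s))
        (div-*ˡ (fromℕ-integral 2) (div-* b≡s (fermat (suc m) (p ∸ s) p≡1+2n -b≡p-s -b-unit)))))

  -- The distance j from r up to the base class n makes the downward induction structural.
  X-mod : ∀ j r a → r ℕ.+ j ≡ n → Div 1 (a - fromℕ r) → Div 2 (X r a)
  X-mod zero r a r+0≡n a≡r = subst (λ r → Div 1 (a - fromℕ r) → Div 2 (X r a))
    (trans (sym r+0≡n) (ℕ.+-identityʳ r)) (X-base a) a≡r
  X-mod (suc j) r a r+j≡n a≡r = X-step r a (subst (r <_) r+j≡n (ℕ.m<m+n r (s≤s z≤n))) a≡r
    (X-mod j (suc r) (a + 1ℚ) (trans (sym (ℕ.+-suc r j)) r+j≡n)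
      (by (trans (cong (λ x → a + 1ℚ - x) (fromℕ-suc r)) (solve 2 (λ a r → a :+ con 1ℚ :- (r :+ con 1ℚ) := a :- r) refl a (fromℕ r))) a≡r))

  -- The sum with weight k in the two ranges of r

  ½-integral : Div 0 ½
  ½-integral = div-cancel (fromℕ-integral 2) 2-unit 1-integral

  -- `c` stands for pt or p(t+1), so that both cases share one formula without a division by p.
  rhs : ℕ → ℚ → ℚ → ℚ
  rhs r a c = (- 1ℚ) ^ℚ r * a * (a + 1ℚ) - ½ * c * (fromℕ 2 * a * (a + 1ℚ) * T a + fromℕ 2 * a + 1ℚ)

  -- The difference splits into the errors of `S₀` and `G` with integral cofactors, and
  -- ½(2n+1)(a-r), the price of replacing n + 1 + a by ½(2a+1).
  S₁-small : ∀ r a → r ≤ n → Div 1 (a - fromℕ r) → Div 2 (S₁ n a - rhs r a (a - fromℕ r))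
  S₁-small r a r≤n a≡r = by
    (trans (cong (_- rhs r a (a - fromℕ r)) (S₁-S₀ n a))
    (solve 7 (λ a n r e s t g → a :* (a :+ con 1ℚ) :* s :- (n :+ con 1ℚ :+ a) :* g
        :- (e :* a :* (a :+ con 1ℚ) :- con ½ :* (a :- r) :* (con (fromℕ 2) :* a :* (a :+ con 1ℚ) :* t :+ con (fromℕ 2) :* a :+ con 1ℚ))
      := a :* (a :+ con 1ℚ) :* (s :- e :+ (a :- r) :* t) :- (n :+ con 1ℚ :+ a) :* (g :- (a :- r))
        :- con ½ :* ((n :* con (fromℕ 2) :+ con 1ℚ) :* (a :- r))) refl
      a (fromℕ n) (fromℕ r) ((- 1ℚ) ^ℚ r) (S₀ n a) (T a) (G n a)))
    (div-minus (div-minus (div-*ˡ (div-*ˡ da (div-+ da 1-integral)) (X-mod (n ∸ r) r a (ℕ.m+[n∸m]≡n r≤n) a≡r))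
        (div-*ˡ (div-+ (div-+ (fromℕ-integral n) 1-integral) da) (G-mod r a r≤n a≡r)))
      (div-*ˡ ½-integral (div-* div-2n+1 a≡r)))
    where
    da : Div 0 a
    da = residue-integral a r a≡r

  -1^-reflect : ∀ r s → s ℕ.+ r ≡ n ℕ.* 2 → (- 1ℚ) ^ℚ s ≡ (- 1ℚ) ^ℚ r
  -1^-reflect r s s+r≡2n = begin
    ε s                         ≡⟨ *-identityʳ (ε s) ⟨
    ε s * 1ℚ                    ≡⟨ cong (ε s *_) (square r) ⟨
    ε s * (ε r * ε r)           ≡⟨ *-assoc (ε s) (ε r) (ε r) ⟨
    ε s * ε r * ε r             ≡⟨ cong (_* ε r) (ε-+ s r) ⟨
    ε (s ℕ.+ r) * ε r           ≡⟨ cong (_* ε r) (trans (cong ε s+r≡2n) (-1^even n)) ⟩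
    1ℚ * ε r                    ≡⟨ *-identityˡ (ε r) ⟩
    ε r                         ∎
    where
    ε : ℕ → ℚ
    ε = (- 1ℚ) ^ℚ_
    ε-+ : ∀ i j → ε (i ℕ.+ j) ≡ ε i * ε j
    ε-+ zero j = sym (*-identityˡ (ε j))
    ε-+ (suc i) j = trans (cong (- 1ℚ *_) (ε-+ i j)) (sym (*-assoc (- 1ℚ) (ε i) (ε j)))
    square : ∀ i → ε i * ε i ≡ 1ℚ
    square i = trans (sym (ε-+ i i)) (trans (cong ε (trans (cong (i ℕ.+_) (sym (ℕ.+-identityʳ i))) (ℕ.*-comm 2 i))) (-1^even i))

  -- `S₁-small` applies to b = -1-a with residue s = 2n - r. There a(a+1) and the sign (-1)^r are
  -- preserved, while a - r + p, 2a + 1 and `T a` all change sign, so the right-hand side is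
  -- unchanged.
  S₁-large : ∀ r a → r > n → r < p → Div 1 (a - fromℕ r) → Div 2 (S₁ n a - rhs r a (a - fromℕ r + fromℕ p))
  S₁-large r a r>n r<p a≡r = by
    (cong₂ _-_ (S₁-reflect n a) (begin
      ε * a * (a + 1ℚ) - ½ * (a - fromℕ r + fromℕ p) * (fromℕ 2 * a * (a + 1ℚ) * T a + fromℕ 2 * a + 1ℚ)
        ≡⟨ solve 5 (λ e a t r p → e :* a :* (a :+ con 1ℚ) :- con ½ :* (a :- r :+ p) :* (con (fromℕ 2) :* a :* (a :+ con 1ℚ) :* t :+ con (fromℕ 2) :* a :+ con 1ℚ)
             := let b = :- con 1ℚ :- a in e :* b :* (b :+ con 1ℚ) :- con ½ :* (:- (a :- r) :- p) :* (con (fromℕ 2) :* b :* (b :+ con 1ℚ) :* (:- t) :+ con (fromℕ 2) :* b :+ con 1ℚ))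
             refl ε a (T a) (fromℕ r) (fromℕ p) ⟩
      ε * b * (b + 1ℚ) - ½ * (- (a - fromℕ r) - fromℕ p) * (fromℕ 2 * b * (b + 1ℚ) * - T a + fromℕ 2 * b + 1ℚ)
        ≡⟨ cong₂ (λ e c → e * b * (b + 1ℚ) - ½ * c * (fromℕ 2 * b * (b + 1ℚ) * - T a + fromℕ 2 * b + 1ℚ)) (sym (-1^-reflect r s s+r≡2n)) (sym b-s) ⟩
      (- 1ℚ) ^ℚ s * b * (b + 1ℚ) - ½ * (b - fromℕ s) * (fromℕ 2 * b * (b + 1ℚ) * - T a + fromℕ 2 * b + 1ℚ)
        ≡⟨ cong (λ t → (- 1ℚ) ^ℚ s * b * (b + 1ℚ) - ½ * (b - fromℕ s) * (fromℕ 2 * b * (b + 1ℚ) * t + fromℕ 2 * b + 1ℚ)) (sym T-b) ⟩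
      rhs s b (b - fromℕ s) ∎))
    (S₁-small s b s≤n b≡s)
    where
    ε = (- 1ℚ) ^ℚ r
    b = - 1ℚ - a
    s = n ℕ.* 2 ∸ r
    r≤2n : r ≤ n ℕ.* 2
    r≤2n = ℕ.≤-pred (subst (r <_) p≡1+2n r<p)
    s+r≡2n : s ℕ.+ r ≡ n ℕ.* 2
    s+r≡2n = ℕ.m∸n+n≡m r≤2n
    s≤n : s ≤ n
    s≤n = ℕ.≤-trans (ℕ.∸-monoʳ-≤ (n ℕ.* 2) (ℕ.<⇒≤ r>n)) (ℕ.≤-reflexive
      (trans (cong (_∸ n) (trans (ℕ.*-comm n 2) (cong (n ℕ.+_) (ℕ.+-identityʳ n)))) (ℕ.m+n∸m≡n n n)))
    p≡s+r+1 : fromℕ p ≡ fromℕ s + fromℕ r + 1ℚ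
    p≡s+r+1 = trans (cong fromℕ (trans p≡1+2n (cong suc (sym s+r≡2n)))) (trans (fromℕ-suc (s ℕ.+ r)) (cong (_+ 1ℚ) (fromℕ-+ s r)))
    b-s : b - fromℕ s ≡ - (a - fromℕ r) - fromℕ p
    b-s = trans (solve 3 (λ a s r → :- con 1ℚ :- a :- s := :- (a :- r) :- (s :+ r :+ con 1ℚ)) refl a (fromℕ s) (fromℕ r))
      (cong (λ x → - (a - fromℕ r) - x) (sym p≡s+r+1))
    b≡s : Div 1 (b - fromℕ s)
    b≡s = by b-s (div-minus (div-neg a≡r) div-p)
    T-b : T b ≡ - T a
    T-b = trans (cong (eulerPoly m) (solve 1 (λ a → :- (:- con 1ℚ :- a) := con 1ℚ :- (:- a)) refl a)) (eulerPoly-reflect n′ (- a))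

-- Writing p as 2n + 1, and the conclusion

odd-prime : ∀ p → Prime p → 3 < p → ∃ λ n → p ≡ suc (suc n ℕ.* 2)
odd-prime p prime-p 3<p with even⊎odd p
... | inj₂ eq with p ℕ./ 2
...   | suc n = n , eq
...   | zero = contradiction (subst (3 <_) eq 3<p) λ { (s≤s ()) }
odd-prime p prime-p 3<p | inj₁ eq with prime⇒irreducible prime-p (divides (p ℕ./ 2) eq)
...   | inj₁ ()
...   | inj₂ 2≡p = contradiction (subst (3 <_) (sym 2≡p) 3<p) λ { (s≤s (s≤s ())) }

theorem3p4 : (p : ℕ) → Prime p → 3 < p →
    (a : ℚ) → InZp p a → ¬ Cong p 1 a 0ℚ →
    (r : ℕ) → r < p → Cong p 1 a (fromℕ r) →
    let t = (a - fromℕ r) * invℕ p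
        S = sumQ (λ k → fromℕ k * binom a k * binom (- 1ℚ - a) k) (ℕ.suc ((p ∸ 1) ℕ./ 2))
        main = ((- 1ℚ) ^ℚ r) * a * (a + 1ℚ)
        W = fromℕ 2 * a * (a + 1ℚ) * eulerPoly (p ∸ 2) (- a) + fromℕ 2 * a + 1ℚ
    in (r ≤ (p ∸ 1) ℕ./ 2 → Cong p 2 S (main - ½ * fromℕ p * t * W))
     × (r > (p ∸ 1) ℕ./ 2 → Cong p 2 S (main - ½ * fromℕ p * (t + 1ℚ) * W))
theorem3p4 p prime-p 3<p a _ _ r r<p a≡r with odd-prime p prime-p 3<p
... | n′ , p≡1+2n = small , large
  where
  open Localisation p prime-p
  open OddPrime p prime-p n′ p≡1+2n
  instance _ = prime⇒nonZero prime-p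
  t W : ℚ
  t = (a - fromℕ r) * invℕ p
  W = fromℕ 2 * a * (a + 1ℚ) * T a + fromℕ 2 * a + 1ℚ
  half : (p ∸ 1) ℕ./ 2 ≡ n
  half = trans (cong (λ q → (q ∸ 1) ℕ./ 2) p≡1+2n) (ℕ.m*n/n≡m n 2)
  p-2≡m : p ∸ 2 ≡ m
  p-2≡m = cong (_∸ 2) p≡1+2n
  pt : fromℕ p * t ≡ a - fromℕ r
  pt = trans (solve 3 (λ p d i → p :* (d :* i) := d :* (i :* p)) refl (fromℕ p) (a - fromℕ r) (invℕ p))
    (trans (cong ((a - fromℕ r) *_) (invℕ-inverse p)) (*-identityʳ (a - fromℕ r)))
  residue : Div 1 (a - fromℕ r)
  residue = cong⇒div a (fromℕ r) a≡r
  Goal : ℕ → ℕ → ℚ → Set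
  Goal h e c = Cong p 2 (sumQ (λ k → fromℕ k * binom a k * binom (- 1ℚ - a) k) (suc h))
    ((- 1ℚ) ^ℚ r * a * (a + 1ℚ) - ½ * fromℕ p * c * (fromℕ 2 * a * (a + 1ℚ) * eulerPoly e (- a) + fromℕ 2 * a + 1ℚ))
  -- Restores the factor p * c of the statement from the division-free `d`, and the expressions
  -- (p-1)/2 and p - 2 from `n` and `m`.
  goal : ∀ c d → fromℕ p * c ≡ d → Div 2 (S₁ n a - rhs r a d) → Goal ((p ∸ 1) ℕ./ 2) (p ∸ 2) c
  goal c d eq dS = subst₂ (λ h e → Goal h e c) (sym half) (sym p-2≡m) (div⇒cong (S₁ n a) ((- 1ℚ) ^ℚ r * a * (a + 1ℚ) - ½ * fromℕ p * c * W) (subst (λ x → Div 2 (S₁ n a - x))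
    (cong (λ x → (- 1ℚ) ^ℚ r * a * (a + 1ℚ) - x * W) (trans (cong (½ *_) (sym eq)) (sym (*-assoc ½ (fromℕ p) c)))) dS))
  small : r ≤ (p ∸ 1) ℕ./ 2 → Goal ((p ∸ 1) ℕ./ 2) (p ∸ 2) t
  small r≤ = goal t (a - fromℕ r) pt (S₁-small r a (subst (r ≤_) half r≤) residue)
  large : r > (p ∸ 1) ℕ./ 2 → Goal ((p ∸ 1) ℕ./ 2) (p ∸ 2) (t + 1ℚ)
  large r> = goal (t + 1ℚ) (a - fromℕ r + fromℕ p)
    (trans (solve 2 (λ p t → p :* (t :+ con 1ℚ) := p :* t :+ p) refl (fromℕ p) t) (cong (_+ fromℕ p) pt))
    (S₁-large r a (subst (_< r) half r>) r<p residue)
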